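{- If $D$ is a decidable domain, then the canonical adjudicator $\chi_D$ is total computable and correct. Two instances are the following. (a) Presburger-conditioned distinctions: $D$ is indexed by the sentences $\phi$ of Presburger arithmetic, with $d_\phi\in\mathbf{M}_D\iff\mathbb{N}\models\phi$. This domain is decidable, and a decision procedure with certificates is obtained by the Büchi–Elgot automata method, the accepting or rejecting run of the automaton associated with $\phi$ serving as the witness. (b) Finite-state re-entry systems: systems of $n$ feedback equations over $\{\text{void},\text{mark}\}$ built from crossing and juxtaposition, observed at one coordinate. The state space has size $\leq 2^n$ and the evolution is deterministic, so the behaviour is ultimately periodic; the pair $(\mu,\pi)$ of transient and period is a certificate scheme: $p\notin\mathbf{M}_D$ if and only if the prefix-plus-cycle of length $\mu+\pi$ of the observed behaviour is mark-free, and $\mu+\pi\leq 2^n$ bounds the certificate effectively in the presentation.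
   Context: A domain is a set $D$ of distinctions (numbered by natural numbers, $D\subseteq\mathbb{N}$) together with a manifestation predicate $\mathbf{M}_D$ appropriate to its presentation. $D$ is decidable if the restricted manifestation problem $\{p\in D:p\in\mathbf{M}_D\}$ is decidable. The canonical adjudicator of $D$ is the function $\chi_D$ on $D$ with $\chi_D(p)=1$ iff $p\in D\setminus\mathbf{M}_D$ (and value $\ne 1$ otherwise). An adjudicator annuls $p$ if its value at $p$ is $1$; it is total if defined on all of $D$; a total adjudicator is correct for $D$ if it annuls exactly the members of $D$ not in $\mathbf{M}_D$. A certificate scheme for $D$ is a computable relation $C(p,w)$ between distinctions and finite objects such that $p\notin\mathbf{M}_D\iff\exists w\,C(p,w)$, with a computable witness function. Finite-state re-entry systems: over the two-element algebra $\{\text{void},\text{mark}\}=\{0,1\}$, crossing is negation and juxtaposition is disjunction. A system consists of $n$ state variables, each updated synchronously by an expression in the state variables built from crossing and juxtaposition (i.e. a synchronous Boolean network), evolving from its initial state, with one designated observed coordinate. The system manifests iff the observed coordinate takes the value mark at some time. The transient $\mu$ and period $\pi$ are those of the eventually periodic orbit of states. -}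

module Defs where

open import Level using (0ℓ)
open import Data.Bool.Base using (Bool; true; false; not; _∧_; _∨_; if_then_else_)
import Data.Bool.Properties as Bool
open import Data.Fin.Base as Fin
  using (Fin; zero; suc; toℕ; fromℕ<; combine; quotient; remainder; finToFun; funToFin)
import Data.Fin.Properties as Fin
open import Data.List.Base as List using (List; []; _∷_)
open import Data.List.Membership.Propositional using (_∈_)
open import Data.List.Relation.Unary.All as All using (All; []; _∷_)
open import Data.Nat.Base using (ℕ; zero; suc; _+_; _*_; _^_; _≤_; _<_; z≤n; s≤s; _%_; _≡ᵇ_; ⌊_/2⌋)
open import Data.Nat.GeneralisedArithmetic using (fold)
open import Data.Nat.Properties using (≤-refl; ≤-reflexive; ≤-trans; +-mono-≤; ⌊n/2⌋-mono; n≡⌊n+n/2⌋)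
open import Data.Product.Base using (∃; ∃-syntax; _×_; _,_; proj₁; proj₂)
open import Data.Sum.Base using (_⊎_)
open import Data.Vec.Base as Vec using (Vec; []; _∷_; lookup)
open import Function.Bundles using (_⇔_)
open import Relation.Binary.PropositionalEquality using (_≡_; refl; sym)
open import Relation.Nullary using (¬_; Dec; does)
open import Relation.Nullary.Decidable using (_×-dec_; _⊎-dec_)
open import Relation.Unary using (Pred)

------------------------------------------------------------------------
-- Numbering of finite objects

triangle : ℕ → ℕ
triangle zero    = zero
triangle (suc n) = suc n + triangle n

-- Cantor's bijection ℕ × ℕ → ℕ.

⟨_,_⟩ : ℕ → ℕ → ℕ
⟨ a , b ⟩ = triangle (a + b) + b

codeList : List ℕ → ℕ
codeList []       = 0
codeList (a ∷ as) = suc ⟨ a , codeList as ⟩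

------------------------------------------------------------------------
-- Computability
--
-- The programming language is Gödel's System T (simply typed λ-calculus
-- with products and primitive recursion at every type) together with one
-- unbounded search.

infixr 6 _⇒_
infixr 7 _⊗_

data Ty : Set where
  nat     : Ty
  _⇒_ _⊗_ : Ty → Ty → Ty

Ctx : Set
Ctx = List Ty

data Tm (Γ : Ctx) : Ty → Set where
  var   : ∀ {σ} → σ ∈ Γ → Tm Γ σ
  lam   : ∀ {σ τ} → Tm (σ ∷ Γ) τ → Tm Γ (σ ⇒ τ)
  _·_   : ∀ {σ τ} → Tm Γ (σ ⇒ τ) → Tm Γ σ → Tm Γ τ
  ze    : Tm Γ nat
  su    : Tm Γ nat → Tm Γ nat
  rec   : ∀ {σ} → Tm Γ σ → Tm Γ (nat ⇒ σ ⇒ σ) → Tm Γ nat → Tm Γ σ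
  pair  : ∀ {σ τ} → Tm Γ σ → Tm Γ τ → Tm Γ (σ ⊗ τ)
  fst   : ∀ {σ τ} → Tm Γ (σ ⊗ τ) → Tm Γ σ
  snd   : ∀ {σ τ} → Tm Γ (σ ⊗ τ) → Tm Γ τ

⟦_⟧ty : Ty → Set
⟦ nat ⟧ty   = ℕ
⟦ σ ⇒ τ ⟧ty = ⟦ σ ⟧ty → ⟦ τ ⟧ty
⟦ σ ⊗ τ ⟧ty = ⟦ σ ⟧ty × ⟦ τ ⟧ty

Env : Ctx → Set
Env = All ⟦_⟧ty

primRec : {A : Set} → A → (ℕ → A → A) → ℕ → A
primRec z s zero    = z
primRec z s (suc n) = s n (primRec z s n)

⟦_⟧ : ∀ {Γ σ} → Tm Γ σ → Env Γ → ⟦ σ ⟧ty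
⟦ var x ⟧     γ = All.lookup γ x
⟦ lam t ⟧     γ = λ a → ⟦ t ⟧ (a ∷ γ)
⟦ t · u ⟧     γ = ⟦ t ⟧ γ (⟦ u ⟧ γ)
⟦ ze ⟧        γ = zero
⟦ su t ⟧      γ = suc (⟦ t ⟧ γ)
⟦ rec z s n ⟧ γ = primRec (⟦ z ⟧ γ) (⟦ s ⟧ γ) (⟦ n ⟧ γ)
⟦ pair t u ⟧  γ = ⟦ t ⟧ γ , ⟦ u ⟧ γ
⟦ fst t ⟧     γ = proj₁ (⟦ t ⟧ γ)
⟦ snd t ⟧     γ = proj₂ (⟦ t ⟧ γ)

Program : Set
Program = Tm [] (nat ⇒ nat ⇒ nat)

-- A program c is a step-indexed evaluator: c x k = 0 means "no output on x
-- at stage k" and c x k = suc v means "output v at stage k".  Its value on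
-- x is the output at the first stage that has one, and is undefined when
-- there is none.  By Kleene's normal form theorem all partial recursive
-- functions ℕ ⇀ ℕ arise in this way (System T contains the primitive
-- recursive functions), and only those do (closed terms of System T of
-- type nat ⇒ nat ⇒ nat denote total recursive functions).

infix 4 _⟨_⟩⇓_

_⟨_⟩⇓_ : Program → ℕ → ℕ → Set
c ⟨ x ⟩⇓ v = ∃ λ k → ⟦ c ⟧ [] x k ≡ suc v × (∀ j → j < k → ⟦ c ⟧ [] x j ≡ 0)

-- On input x the program c correctly decides the proposition P.

Answers : Program → ℕ → Set → Set
Answers c x P = (P × c ⟨ x ⟩⇓ 1) ⊎ (¬ P × c ⟨ x ⟩⇓ 0)

------------------------------------------------------------------------
-- Domains, adjudicators and certificates

record Domain : Set₁ where
  field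
    Dist : Pred ℕ 0ℓ
    𝐌    : Pred ℕ 0ℓ

open Domain public

-- Inputs outside Dist D are not constrained: the problem is restricted to D.

DecidableDomain : Domain → Set
DecidableDomain D = ∃ λ c → ∀ p → Dist D p → Answers c p (𝐌 D p)

record Adjudicator : Set₁ where
  field
    _↦_        : ℕ → ℕ → Set
    functional : ∀ {p v v′} → p ↦ v → p ↦ v′ → v ≡ v′

Annuls : Adjudicator → ℕ → Set
Annuls A p = Adjudicator._↦_ A p 1

Total : Domain → Adjudicator → Set
Total D A = ∀ p → Dist D p → ∃ λ v → Adjudicator._↦_ A p v

Correct : Domain → Adjudicator → Set
Correct D A = ∀ p → Dist D p → Annuls A p ⇔ (¬ 𝐌 D p)

Computable : Domain → Adjudicator → Set
Computable D A =
  ∃ λ c → ∀ p → Dist D p → ∀ v → Adjudicator._↦_ A p v ⇔ c ⟨ p ⟩⇓ v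

-- The value different from 1 is taken to be 0.

data χ-Graph (D : Domain) (p : ℕ) : ℕ → Set where
  annulled : Dist D p → ¬ 𝐌 D p → χ-Graph D p 1
  kept     : Dist D p → 𝐌 D p → χ-Graph D p 0

χ : Domain → Adjudicator
χ D = record { _↦_ = χ-Graph D ; functional = functional }
  where
  open import Relation.Nullary using (contradiction)
  functional : ∀ {p v v′} → χ-Graph D p v → χ-Graph D p v′ → v ≡ v′
  functional (annulled _ _)  (annulled _ _)  = refl
  functional (annulled _ ¬m) (kept _ m)      = contradiction m ¬m
  functional (kept _ m)      (annulled _ ¬m) = contradiction m ¬m
  functional (kept _ _)      (kept _ _)      = refl

-- C is a computable relation, with a computable witness function, such
-- that p satisfies P iff C p w for some finite object (numbered) w.

record Certifies (D : Domain) (P : Pred ℕ 0ℓ) (C : ℕ → ℕ → Set) : Set where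
  field
    computable : ∃ λ c → ∀ p → Dist D p → ∀ w → Answers c ⟨ p , w ⟩ (C p w)
    certifies  : ∀ p → Dist D p → P p ⇔ (∃ λ w → C p w)
    witness    : ∃ λ c → ∀ p → Dist D p → P p → ∃ λ w → c ⟨ p ⟩⇓ w × C p w

CertificateScheme : (D : Domain) → (ℕ → ℕ → Set) → Set
CertificateScheme D C = Certifies D (λ p → ¬ 𝐌 D p) C

-- A program that on every p in D outputs its verdict (the value of χ at p)
-- together with a certificate for that verdict.

CertifiedDecision : (D : Domain) (C⁺ C⁻ : ℕ → ℕ → Set) → Set
CertifiedDecision D C⁺ C⁻ =
  ∃ λ c → ∀ p → Dist D p → ∃ λ w →
      (𝐌 D p     × C⁺ p w × c ⟨ p ⟩⇓ ⟨ 0 , w ⟩)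
    ⊎ ((¬ 𝐌 D p) × C⁻ p w × c ⟨ p ⟩⇓ ⟨ 1 , w ⟩)

------------------------------------------------------------------------
-- Presburger arithmetic

infixl 7 _⊕_
infix  6 _≐_

data Term (n : ℕ) : Set where
  var     : Fin n → Term n
  𝟘 𝟙     : Term n
  _⊕_     : Term n → Term n → Term n

data Formula : ℕ → Set where
  _≐_              : ∀ {n} → Term n → Term n → Formula n
  neg              : ∀ {n} → Formula n → Formula n
  conj disj imp    : ∀ {n} → Formula n → Formula n → Formula n
  all ex           : ∀ {n} → Formula (suc n) → Formula n

Sentence : Set
Sentence = Formula 0

value : ∀ {n} → Term n → Vec ℕ n → ℕ
value (var i) ρ = lookup ρ i
value 𝟘       ρ = 0
value 𝟙       ρ = 1
value (s ⊕ t) ρ = value s ρ + value t ρ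

infix 4 _⊨_

_⊨_ : ∀ {n} → Vec ℕ n → Formula n → Set
ρ ⊨ s ≐ t    = value s ρ ≡ value t ρ
ρ ⊨ neg φ    = ¬ (ρ ⊨ φ)
ρ ⊨ conj φ ψ = (ρ ⊨ φ) × (ρ ⊨ ψ)
ρ ⊨ disj φ ψ = (ρ ⊨ φ) ⊎ (ρ ⊨ ψ)
ρ ⊨ imp φ ψ  = ρ ⊨ φ → ρ ⊨ ψ
ρ ⊨ all φ    = ∀ x → (x ∷ ρ) ⊨ φ
ρ ⊨ ex φ     = ∃ λ x → (x ∷ ρ) ⊨ φ

ℕ⊨_ : Sentence → Set
ℕ⊨ φ = [] ⊨ φ

codeTerm : ∀ {n} → Term n → ℕ
codeTerm (var i) = ⟨ 0 , toℕ i ⟩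
codeTerm 𝟘       = ⟨ 1 , 0 ⟩
codeTerm 𝟙       = ⟨ 2 , 0 ⟩
codeTerm (s ⊕ t) = ⟨ 3 , ⟨ codeTerm s , codeTerm t ⟩ ⟩

codeFormula : ∀ {n} → Formula n → ℕ
codeFormula (s ≐ t)    = ⟨ 0 , ⟨ codeTerm s , codeTerm t ⟩ ⟩
codeFormula (neg φ)    = ⟨ 1 , codeFormula φ ⟩
codeFormula (conj φ ψ) = ⟨ 2 , ⟨ codeFormula φ , codeFormula ψ ⟩ ⟩
codeFormula (disj φ ψ) = ⟨ 3 , ⟨ codeFormula φ , codeFormula ψ ⟩ ⟩
codeFormula (imp φ ψ)  = ⟨ 4 , ⟨ codeFormula φ , codeFormula ψ ⟩ ⟩
codeFormula (all φ)    = ⟨ 5 , codeFormula φ ⟩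
codeFormula (ex φ)     = ⟨ 6 , codeFormula φ ⟩

Presburger : Domain
Presburger = record
  { Dist = λ p → ∃ λ (φ : Sentence) → p ≡ codeFormula φ
  ; 𝐌    = λ p → ∃ λ (φ : Sentence) → p ≡ codeFormula φ × ℕ⊨ φ
  }

------------------------------------------------------------------------
-- The Büchi–Elgot automata method
--
-- The automaton of a formula with n free variables reads n binary
-- expansions in parallel, least significant bits first; the number of
-- trailing zero letters is immaterial.

record DFA (n : ℕ) : Set where
  field
    size  : ℕ
    start : Fin size
    step  : Fin size → Vec Bool n → Fin size
    final : Fin size → Bool

open DFA public

bit : Bool → ℕ
bit false = 0
bit true  = 1

-- value t ρ is constant t plus a linear form in ρ, and linear t b is that
-- linear form at a vector b of bits.

constant : ∀ {n} → Term n → ℕ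
constant (var i) = 0
constant 𝟘       = 0
constant 𝟙       = 1
constant (s ⊕ t) = constant s + constant t

linear : ∀ {n} → Term n → Vec Bool n → ℕ
linear (var i) b = bit (lookup b i)
linear 𝟘       b = 0
linear 𝟙       b = 0
linear (s ⊕ t) b = linear s b + linear t b

weight : ∀ {n} → Term n → ℕ
weight (var i) = 1
weight 𝟘       = 0
weight 𝟙       = 1
weight (s ⊕ t) = weight s + weight t

bit≤1 : ∀ b → bit b ≤ 1
bit≤1 false = z≤n
bit≤1 true  = ≤-refl

constant≤weight : ∀ {n} (t : Term n) → constant t ≤ weight t
constant≤weight (var i) = z≤n
constant≤weight 𝟘       = z≤n
constant≤weight 𝟙       = ≤-refl
constant≤weight (s ⊕ t) = +-mono-≤ (constant≤weight s) (constant≤weight t)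

linear≤weight : ∀ {n} (t : Term n) b → linear t b ≤ weight t
linear≤weight (var i) b = bit≤1 (lookup b i)
linear≤weight 𝟘       b = z≤n
linear≤weight 𝟙       b = z≤n
linear≤weight (s ⊕ t) b = +-mono-≤ (linear≤weight s b) (linear≤weight t b)

-- The bit-serial evaluation of a term keeps a carry, initially its constant.

Carry : ∀ {n} → Term n → Set
Carry t = Fin (suc (weight t))

carry₀ : ∀ {n} (t : Term n) → Carry t
carry₀ t = fromℕ< (s≤s (constant≤weight t))

total : ∀ {n} (t : Term n) → Carry t → Vec Bool n → ℕ
total t c b = toℕ c + linear t b

carry : ∀ {n} (t : Term n) → Carry t → Vec Bool n → Carry t
carry t c b = fromℕ< (s≤s (≤-trans
  (⌊n/2⌋-mono (+-mono-≤ (Fin.toℕ≤pred[n] c) (linear≤weight t b)))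
  (≤-reflexive (sym (n≡⌊n+n/2⌋ (weight t))))))

-- State zero is the dead state reached when the two sides differ in some
-- bit; the other states are the pairs of carries.

equality : ∀ {n} → Term n → Term n → DFA n
equality {n} s t = record
  { size  = suc (suc (weight s) * suc (weight t))
  ; start = suc (combine (carry₀ s) (carry₀ t))
  ; step  = δ
  ; final = F
  }
  where
  State : Set
  State = Fin (suc (suc (weight s) * suc (weight t)))

  left : Fin (suc (weight s) * suc (weight t)) → Carry s
  left = quotient (suc (weight t))

  right : Fin (suc (weight s) * suc (weight t)) → Carry t
  right = remainder {suc (weight s)} (suc (weight t))

  δ : State → Vec Bool n → State
  δ zero    b = zero
  δ (suc q) b =
    if total s (left q) b % 2 ≡ᵇ total t (right q) b % 2
    then suc (combine (carry s (left q) b) (carry t (right q) b))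
    else zero

  F : State → Bool
  F zero    = false
  F (suc q) = toℕ (left q) ≡ᵇ toℕ (right q)

complement : ∀ {n} → DFA n → DFA n
complement A = record
  { size  = size A
  ; start = start A
  ; step  = step A
  ; final = λ q → not (final A q)
  }

product : ∀ {n} → (Bool → Bool → Bool) → DFA n → DFA n → DFA n
product _∙_ A B = record
  { size  = size A * size B
  ; start = combine (start A) (start B)
  ; step  = λ q b → combine (step A (left q) b) (step B (right q) b)
  ; final = λ q → final A (left q) ∙ final B (right q)
  }
  where
  left : Fin (size A * size B) → Fin (size A)
  left = quotient (size B)

  right : Fin (size A * size B) → Fin (size B)
  right = remainder {size A} (size B)

-- Sets of states are numbered through their characteristic functions.

Subset : ℕ → Set
Subset N = Fin (2 ^ N)

infix 4 _∋_ _∋?_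

_∋_ : ∀ {N} → Subset N → Fin N → Set
S ∋ q = finToFun S q ≡ suc zero

_∋?_ : ∀ {N} (S : Subset N) (q : Fin N) → Dec (S ∋ q)
S ∋? q = finToFun S q Fin.≟ suc zero

comprehension : ∀ {N} {P : Pred (Fin N) 0ℓ} → (∀ q → Dec (P q)) → Subset N
comprehension P? = funToFin (λ q → if does (P? q) then suc zero else zero)

-- Erasing the first track gives a nondeterministic automaton, which is
-- determinised by the subset construction.  The erased number may have
-- more digits than were read, so a set is final if padding the remaining
-- tracks by zeros can lead it to a final state; this need only be tested
-- for fewer than 2 ^ size A padding letters, the number of sets.

project : ∀ {n} → DFA (suc n) → DFA n
project {n} A = record
  { size  = 2 ^ size A
  ; start = comprehension (λ q → q Fin.≟ start A)
  ; step  = δ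
  ; final = λ S → does (Fin.any? λ (k : Fin (2 ^ size A)) → Fin.any? λ q →
              (pad S (toℕ k) ∋? q) ×-dec (final A q Bool.≟ true))
  }
  where
  δ : Subset (size A) → Vec Bool n → Subset (size A)
  δ S b = comprehension (λ q′ → Fin.any? λ q →
    (S ∋? q) ×-dec
    ((step A q (false ∷ b) Fin.≟ q′) ⊎-dec (step A q (true ∷ b) Fin.≟ q′)))

  pad : Subset (size A) → ℕ → Subset (size A)
  pad S = fold S (λ S′ → δ S′ (Vec.replicate n false))

automaton : ∀ {n} → Formula n → DFA n
automaton (s ≐ t)    = equality s t
automaton (neg φ)    = complement (automaton φ)
automaton (conj φ ψ) = product _∧_ (automaton φ) (automaton ψ)
automaton (disj φ ψ) = product _∨_ (automaton φ) (automaton ψ)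
automaton (imp φ ψ)  = product (λ a b → not a ∨ b) (automaton φ) (automaton ψ)
automaton (all φ)    = complement (project (complement (automaton φ)))
automaton (ex φ)     = project (automaton φ)

-- Run A q w qs r : reading the word w from state q, the automaton visits
-- the states qs (including both ends) and stops in state r.

data Run {n} (A : DFA n) : Fin (size A) → List (Vec Bool n) →
                           List (Fin (size A)) → Fin (size A) → Set where
  stop : ∀ {q} → Run A q [] (q ∷ []) q
  read : ∀ {q b w qs r} → Run A (step A q b) w qs r → Run A q (b ∷ w) (q ∷ qs) r

AcceptingRun RejectingRun : ∀ {n} (A : DFA n) → List (Fin (size A)) → Set
AcceptingRun A qs = ∃[ w ] ∃[ r ] Run A (start A) w qs r × final A r ≡ true
RejectingRun A qs = ∃[ w ] ∃[ r ] Run A (start A) w qs r × final A r ≡ false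

codeRun : ∀ {N} → List (Fin N) → ℕ
codeRun qs = codeList (List.map toℕ qs)

-- A sentence has no tracks, so every word over its one-letter alphabet
-- encodes the empty tuple, and any of them may be used for the run.

AcceptingCertificate RejectingCertificate : ℕ → ℕ → Set
AcceptingCertificate p w = ∃ λ (φ : Sentence) → ∃ λ qs →
  p ≡ codeFormula φ × w ≡ codeRun qs × AcceptingRun (automaton φ) qs
RejectingCertificate p w = ∃ λ (φ : Sentence) → ∃ λ qs →
  p ≡ codeFormula φ × w ≡ codeRun qs × RejectingRun (automaton φ) qs

------------------------------------------------------------------------
-- Finite-state re-entry systems.  In Bool, false is void and true is mark.

data Expr (n : ℕ) : Set where
  var   : Fin n → Expr n
  cross : Expr n → Expr n
  juxt  : Expr n → Expr n → Expr n

eval : ∀ {n} → Expr n → Vec Bool n → Bool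
eval (var i)    s = lookup s i
eval (cross e)  s = not (eval e s)
eval (juxt e f) s = eval e s ∨ eval f s

State : ℕ → Set
State n = Vec Bool n

record System (n : ℕ) : Set where
  field
    equations : Vec (Expr n) n
    initial   : State n
    observed  : Fin n

open System public

next : ∀ {n} → System n → State n → State n
next S s = Vec.map (λ e → eval e s) (equations S)

orbit : ∀ {n} → System n → ℕ → State n
orbit S t = fold (initial S) (next S) t

behaviour : ∀ {n} → System n → ℕ → Bool
behaviour S t = lookup (orbit S t) (observed S)

Manifests : ∀ {n} → System n → Set
Manifests S = ∃ λ t → behaviour S t ≡ true

MarkFree : ∀ {n} → System n → ℕ → Set
MarkFree S ℓ = ∀ t → t < ℓ → behaviour S t ≡ false

PeriodicFrom : {A : Set} → (ℕ → A) → (μ π : ℕ) → Set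
PeriodicFrom s μ π = 0 < π × (∀ t → μ ≤ t → s (t + π) ≡ s t)

UltimatelyPeriodic : {A : Set} → (ℕ → A) → Set
UltimatelyPeriodic s = ∃ λ μ → ∃ λ π → PeriodicFrom s μ π

record IsTransientPeriod {A : Set} (s : ℕ → A) (μ π : ℕ) : Set where
  field
    periodic : PeriodicFrom s μ π
    least    : ∀ μ′ π′ → PeriodicFrom s μ′ π′ → μ ≤ μ′ × π ≤ π′

codeExpr : ∀ {n} → Expr n → ℕ
codeExpr (var i)    = ⟨ 0 , toℕ i ⟩
codeExpr (cross e)  = ⟨ 1 , codeExpr e ⟩
codeExpr (juxt e f) = ⟨ 2 , ⟨ codeExpr e , codeExpr f ⟩ ⟩

codeSystem : ∀ {n} → System n → ℕ
codeSystem {n} S =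
  ⟨ n , ⟨ toℕ (observed S) ,
    ⟨ codeList (List.map bit (Vec.toList (initial S))) ,
      codeList (List.map codeExpr (Vec.toList (equations S))) ⟩ ⟩ ⟩

ReEntry : Domain
ReEntry = record
  { Dist = λ p → ∃ λ n → ∃ λ (S : System n) → p ≡ codeSystem S
  ; 𝐌    = λ p → ∃ λ n → ∃ λ (S : System n) → p ≡ codeSystem S × Manifests S
  }

TransientPeriodCertificate : ℕ → ℕ → Set
TransientPeriodCertificate p w =
  ∃ λ n → ∃ λ (S : System n) → ∃ λ μ → ∃ λ π →
    p ≡ codeSystem S × w ≡ ⟨ μ , π ⟩ ×
    IsTransientPeriod (orbit S) μ π × MarkFree S (μ + π)

{-# OPTIONS --safe #-}
module Submission where

-- Every decision procedure is a closed term of Gödel's System T.  The lemma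
-- about an opaque term takes proofs of what its arguments evaluate to, so that
-- the correctness proof of a program has the same shape as the program.
--
-- (a) Recursion at higher type builds from the code of φ the automaton of φ, as
-- a value whose transition and acceptance functions act on state numbers.  The
-- automaton accepts a word iff the encoded tuple satisfies φ: the carries of an
-- equation bound what is still to be added, and an existential quantifier guesses
-- a track, where fewer than 2 ^ size padding letters suffice because the orbit of
-- a set of states under the zero letter repeats itself by then.
--
-- (b) The orbit of a system is a lasso: its first repetition x(μ + π) = x(μ)
-- gives the transient and the period, and the pairwise distinct states before
-- it number at most 2 ^ n.  Being a lasso can be checked by finitely many
-- comparisons of states.
--
-- Witnesses are found by searching for the first number that passes a check.

open import Defs
open import Data.Bool.Base using (Bool; true; false; not; _∧_; _∨_; if_then_else_; T)
import Data.Bool.Properties as Bool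
open import Data.Fin.Base as Fin using (Fin; zero; suc; toℕ; combine; quotient; remainder; finToFun; funToFin)
import Data.Fin.Properties as Fin
open import Data.List.Base as List using (List; []; _∷_; _++_)
open import Data.List.Properties using (∷-injective)
open import Data.List.Relation.Unary.All using (All; []; _∷_)
open import Data.List.Relation.Unary.Any using (here; there)
open import Data.Nat.Base
open import Data.Nat.DivMod
open import Data.Nat.GeneralisedArithmetic using (fold; iterate; iterate-is-fold)
open import Data.Nat.Properties
open import Data.Nat.Tactic.RingSolver using (solve-∀)
open import Data.Product.Base using (∃; ∃₂; _×_; _,_; proj₁; proj₂; uncurry)
open import Data.Product.Function.NonDependent.Propositional using (_×-⇔_)
open import Data.Sum.Base as Sum using (_⊎_; inj₁; inj₂)
open import Data.Sum.Function.Propositional using (_⊎-⇔_)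
open import Data.Vec.Base as Vec using (Vec; []; _∷_; lookup)
import Data.Vec.Properties as Vec
open import Function.Base using (_∘_; case_of_)
open import Function.Bundles using (_⇔_; _↣_; mk⇔; mk↣; Equivalence; Injection)
open import Function.Construct.Composition using (_⇔-∘_)
open import Function.Construct.Symmetry using (⇔-sym)
open import Level using (0ℓ)
open import Relation.Binary.Definitions using (DecidableEquality; tri<; tri≈; tri>)
open import Relation.Binary.PropositionalEquality
open import Relation.Nullary
open import Relation.Nullary.Decidable as Dec using (_×-dec_; _⊎-dec_; decidable-stable)
open import Relation.Unary using (Pred)

open Equivalence using (to; from)
open Tm using () renaming (_·_ to infixl 20 _∙_)

-- Cantor pairing

-- Subset constructions nest, so the sizes of the automata are iterated exponentials. Higher types
-- make this manageable: a transition function is itself a value, every construction on automata is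
-- one combinator, and no transition table is ever coded. Programs receive numbers, while the
-- domains speak of some object that has a given number. The object is never recovered from its
-- number. A program is shown correct for every object with that code, and injectivity of the
-- codings is replaced by the fact that a program gives one answer per number. The reasoning is
-- constructive, and decidability comes from the programs and automata themselves. In particular,
-- the automaton of a universal formula is built as that of `¬ ∃ ¬`, which is faithful because
-- recognition by an automaton makes satisfaction decidable. Minimality of transient and period
-- quantifies over all pairs of numbers and has to be traded for distinctness on an initial segment
-- before it can be tested.

unpairStep : ℕ × ℕ → ℕ × ℕ
unpairStep (zero  , b) = suc b , 0
unpairStep (suc a , b) = a , suc b

-- Walking along the diagonals one number at a time inverts the pairing by primitive recursion,
-- without inverting `triangle`.
unpair : ℕ → ℕ × ℕ
unpair zero    = 0 , 0
unpair (suc z) = unpairStep (unpair z)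

π₁ π₂ : ℕ → ℕ
π₁ z = proj₁ (unpair z)
π₂ z = proj₂ (unpair z)

pair-unpairStep : ∀ a b → uncurry ⟨_,_⟩ (unpairStep (a , b)) ≡ suc ⟨ a , b ⟩
pair-unpairStep zero b = begin
  triangle (suc b + 0) + 0   ≡⟨ +-identityʳ _ ⟩
  triangle (suc b + 0)       ≡⟨ cong triangle (+-identityʳ (suc b)) ⟩
  suc (b + triangle b)       ≡⟨ cong suc (+-comm b _) ⟩
  suc (triangle b + b)       ∎
  where open ≡-Reasoning
pair-unpairStep (suc a) b = begin
  triangle (a + suc b) + suc b   ≡⟨ cong (λ s → triangle s + suc b) (+-suc a b) ⟩
  triangle (suc (a + b)) + suc b ≡⟨ +-suc _ b ⟩
  suc (triangle (suc (a + b)) + b) ∎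
  where open ≡-Reasoning

pair-unpair : ∀ z → ⟨ π₁ z , π₂ z ⟩ ≡ z
pair-unpair zero    = refl
pair-unpair (suc z) = trans (pair-unpairStep (π₁ z) (π₂ z)) (cong suc (pair-unpair z))

unpair-pair : ∀ a b → unpair ⟨ a , b ⟩ ≡ (a , b)
unpair-pair a b = along (a + b) a b refl
  where
  successor : ∀ a b → unpair ⟨ a , b ⟩ ≡ (a , b) →
              unpair (uncurry ⟨_,_⟩ (unpairStep (a , b))) ≡ unpairStep (a , b)
  successor a b eq = trans (cong unpair (pair-unpairStep a b)) (cong unpairStep eq)

  -- The numbering runs through the diagonals a + b = s in the order of b.
  along : ∀ s a b → a + b ≡ s → unpair ⟨ a , b ⟩ ≡ (a , b)
  along s       a       (suc b) eq = successor (suc a) b (along s (suc a) b (trans (sym (+-suc a b)) eq))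
  along zero    zero    zero    eq = refl
  along (suc s) (suc a) zero    eq = successor 0 a (along s 0 a (trans (sym (+-identityʳ a)) (suc-injective eq)))

π₁-pair : ∀ a b → π₁ ⟨ a , b ⟩ ≡ a
π₁-pair a b = cong proj₁ (unpair-pair a b)

π₂-pair : ∀ a b → π₂ ⟨ a , b ⟩ ≡ b
π₂-pair a b = cong proj₂ (unpair-pair a b)

n≤triangle : ∀ n → n ≤ triangle n
n≤triangle zero    = z≤n
n≤triangle (suc n) = m≤m+n (suc n) (triangle n)

left≤pair : ∀ a b → a ≤ ⟨ a , b ⟩
left≤pair a b = ≤-trans (m≤m+n a b) (≤-trans (n≤triangle (a + b)) (m≤m+n _ b))

right≤pair : ∀ a b → b ≤ ⟨ a , b ⟩
right≤pair a b = m≤n+m b _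

-- The positive tag makes the bound strict; with tag 0 it fails at `⟨ 0 , 0 ⟩`, which is 0. Every
-- constructor with arguments of its own kind has a positive tag, so recursion on codes reaches its
-- subtrees.
right<pair : ∀ a b → b < ⟨ suc a , b ⟩
right<pair a b = +-monoˡ-≤ b (s≤s z≤n)

left<node : ∀ t a b → a < ⟨ suc t , ⟨ a , b ⟩ ⟩
left<node t a b = ≤-<-trans (left≤pair a b) (right<pair t _)

right<node : ∀ t a b → b < ⟨ suc t , ⟨ a , b ⟩ ⟩
right<node t a b = ≤-<-trans (right≤pair a b) (right<pair t _)

-- Quotients and remainders

quotient-remainder-unique : ∀ {q q′ r r′ m} → r < m → r′ < m →
  q * m + r ≡ q′ * m + r′ → q ≡ q′ × r ≡ r′
quotient-remainder-unique {q} {q′} {r} {r′} {m@(suc _)} r<m r′<m eq = q≡q′ , r≡r′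
  where
  rem≡ : ∀ q r → r < m → (q * m + r) % m ≡ r
  rem≡ q r r<m = trans (cong (_% m) (+-comm (q * m) r))
                       (trans ([m+kn]%n≡m%n r q m) (m<n⇒m%n≡m r<m))
  r≡r′ : r ≡ r′
  r≡r′ = trans (sym (rem≡ q r r<m)) (trans (cong (_% m) eq) (rem≡ q′ r′ r′<m))
  q≡q′ : q ≡ q′
  q≡q′ = *-cancelʳ-≡ q q′ m (+-cancelʳ-≡ r _ _ (trans eq (cong (q′ * m +_) (sym r≡r′))))

halves : ∀ n → n ≡ ⌊ n /2⌋ * 2 + n % 2
halves zero          = refl
halves (suc zero)    = refl
halves (suc (suc n)) = cong (2 +_) (halves n)

-- Programming in System T

private variable
  Γ : Ctx
  γ : Env Γ
  σ τ : Ty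
  P Q : Set
  a b k m n x y : ℕ

v0 : Tm (σ ∷ Γ) σ
v0 = var (here refl)

v1 : ∀ {σ₀} → Tm (σ₀ ∷ σ ∷ Γ) σ
v1 = var (there (here refl))

v2 : ∀ {σ₀ σ₁} → Tm (σ₀ ∷ σ₁ ∷ σ ∷ Γ) σ
v2 = var (there (there (here refl)))

v3 : ∀ {σ₀ σ₁ σ₂} → Tm (σ₀ ∷ σ₁ ∷ σ₂ ∷ σ ∷ Γ) σ
v3 = var (there (there (there (here refl))))

v4 : ∀ {σ₀ σ₁ σ₂ σ₃} → Tm (σ₀ ∷ σ₁ ∷ σ₂ ∷ σ₃ ∷ σ ∷ Γ) σ
v4 = var (there (there (there (there (here refl)))))

v5 : ∀ {σ₀ σ₁ σ₂ σ₃ σ₄} → Tm (σ₀ ∷ σ₁ ∷ σ₂ ∷ σ₃ ∷ σ₄ ∷ σ ∷ Γ) σ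
v5 = var (there (there (there (there (there (here refl))))))

Closed : Ty → Set
Closed σ = ∀ {Γ} → Tm Γ σ

primRec-unique : ∀ {A : Set} {z : A} {s} (f : ℕ → A) →
  z ≡ f 0 → (∀ k → s k (f k) ≡ f (suc k)) → ∀ n → primRec z s n ≡ f n
primRec-unique         f z≡ s≡ zero    = z≡
primRec-unique {s = s} f z≡ s≡ (suc n) =
  trans (cong (s n) (primRec-unique f z≡ s≡ n)) (s≡ n)

primRec-induction : ∀ {A : Set} {z : A} {s} (R : ℕ → A → Set) →
  R 0 z → (∀ {k r} → R k r → R (suc k) (s k r)) → ∀ n → R n (primRec z s n)
primRec-induction R Rz Rs zero    = Rz
primRec-induction R Rz Rs (suc n) = Rs (primRec-induction R Rz Rs n)

-- The output bit comes together with a proof or refutation, so the correctness of a program also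
-- shows that the proposition is decidable. Constructive steps such as `decidable-stable` and
-- `least` draw on this.
Decides : ℕ → Set → Set
Decides v P = (P × v ≡ 1) ⊎ (¬ P × v ≡ 0)

decides-map : P ⇔ Q → Decides x P → Decides x Q
decides-map P⇔Q (inj₁ (p , eq))  = inj₁ (to P⇔Q p , eq)
decides-map P⇔Q (inj₂ (¬p , eq)) = inj₂ (¬p ∘ from P⇔Q , eq)

decides⇒dec : Decides x P → Dec P
decides⇒dec (inj₁ (p , _))  = yes p
decides⇒dec (inj₂ (¬p , _)) = no ¬p

decides-true : Decides x P → P → x ≡ 1
decides-true (inj₁ (_ , eq)) p = eq
decides-true (inj₂ (¬p , _)) p = contradiction p ¬p

true-decides : Decides x P → x ≡ 1 → P
true-decides (inj₁ (p , _)) _ = p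
true-decides (inj₂ (_ , refl)) ()

decides⇒bit : Decides x P → (P? : Dec P) → x ≡ bit (does P?)
decides⇒bit (inj₁ (p , eq))  (yes _) = eq
decides⇒bit (inj₁ (p , eq))  (no ¬p) = contradiction p ¬p
decides⇒bit (inj₂ (¬p , eq)) (yes p) = contradiction p ¬p
decides⇒bit (inj₂ (¬p , eq)) (no _)  = eq

bit⇒decides : ∀ {b} → x ≡ bit b → Decides x (b ≡ true)
bit⇒decides {b = true}  eq = inj₁ (refl , eq)
bit⇒decides {b = false} eq = inj₂ ((λ ()) , eq)

decides⇒≡bit : ∀ {b} → Decides x (b ≡ true) → x ≡ bit b
decides⇒≡bit {b = true}  (inj₁ (_ , eq)) = eq
decides⇒≡bit {b = true}  (inj₂ (ne , _)) = contradiction refl ne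
decides⇒≡bit {b = false} (inj₂ (_ , eq)) = eq



-- Conditionals, arithmetic and truth values

opaque
  ifᵀ : Closed (nat ⇒ σ ⇒ σ ⇒ σ)
  ifᵀ = lam (lam (lam (rec v0 (lam (lam v3)) v2)))

  -- An opaque conditional does not reduce, so this principle takes the place of case distinction;
  -- each branch may assume the outcome of the test.
  if-elim : ∀ {t e : ⟦ σ ⟧ty} (R : ⟦ σ ⟧ty → Set) → Decides x P →
            (P → R t) → (¬ P → R e) → R (⟦ ifᵀ {σ} ⟧ γ x t e)
  if-elim R (inj₁ (p , refl))  Rt Re = Rt p
  if-elim R (inj₂ (¬p , refl)) Rt Re = Re ¬p

infix 5 if_then_else_end

if_then_else_end : Tm Γ nat → Tm Γ σ → Tm Γ σ → Tm Γ σ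
if c then t else e end = ifᵀ ∙ c ∙ t ∙ e

one : Closed nat
one = su ze

opaque
  predᵀ : Closed (nat ⇒ nat)
  predᵀ = lam (rec ze (lam (lam v1)) v0)

  pred≡ : x ≡ m → ⟦ predᵀ ⟧ γ x ≡ pred m
  pred≡ {m = zero}  refl = refl
  pred≡ {m = suc m} refl = refl

  addᵀ : Closed (nat ⇒ nat ⇒ nat)
  addᵀ = lam (lam (rec v0 (lam (lam (su v0))) v1))

  add≡ : x ≡ m → y ≡ n → ⟦ addᵀ ⟧ γ x y ≡ m + n
  add≡ {m = m} {n = n} refl refl = primRec-unique (_+ n) refl (λ k → refl) m

opaque
  mulᵀ : Closed (nat ⇒ nat ⇒ nat)
  mulᵀ = lam (lam (rec ze (lam (lam (addᵀ ∙ v2 ∙ v0))) v1))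

  mul≡ : x ≡ m → y ≡ n → ⟦ mulᵀ ⟧ γ x y ≡ m * n
  mul≡ {m = m} {n = n} refl refl = primRec-unique (_* n) refl (λ k → add≡ refl refl) m

opaque
  pow2ᵀ : Closed (nat ⇒ nat)
  pow2ᵀ = lam (rec one (lam (lam (mulᵀ ∙ su one ∙ v0))) v0)

  pow2≡ : x ≡ m → ⟦ pow2ᵀ ⟧ γ x ≡ 2 ^ m
  pow2≡ {m = m} refl = primRec-unique (2 ^_) refl (λ k → mul≡ refl refl) m

opaque
  triangleᵀ : Closed (nat ⇒ nat)
  triangleᵀ = lam (rec ze (lam (lam (addᵀ ∙ su v1 ∙ v0))) v0)

  triangle≡ : x ≡ m → ⟦ triangleᵀ ⟧ γ x ≡ triangle m
  triangle≡ {m = m} refl = primRec-unique triangle refl (λ k → add≡ refl refl) m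

opaque
  pairᵀ : Closed (nat ⇒ nat ⇒ nat)
  pairᵀ = lam (lam (addᵀ ∙ (triangleᵀ ∙ (addᵀ ∙ v1 ∙ v0)) ∙ v0))

  pair≡ : x ≡ m → y ≡ n → ⟦ pairᵀ ⟧ γ x y ≡ ⟨ m , n ⟩
  pair≡ p q = add≡ (triangle≡ (add≡ p q)) q

opaque
  unfolding ifᵀ

  notᵀ : Closed (nat ⇒ nat)
  notᵀ = lam (rec one (lam (lam ze)) v0)

  decides-¬ : Decides x P → Decides (⟦ notᵀ ⟧ γ x) (¬ P)
  decides-¬ (inj₁ (p , refl))  = inj₂ ((λ ¬p → ¬p p) , refl)
  decides-¬ (inj₂ (¬p , refl)) = inj₁ (¬p , refl)

  andᵀ : Closed (nat ⇒ nat ⇒ nat)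
  andᵀ = lam (lam (if v1 then v0 else ze end))

  -- Needed where the second test is meaningful only after the first has succeeded: in `acceptingᵀ`
  -- the recursive call on the tail is justified only for a nonempty list.
  decides-×-given : Decides x P → (P → Decides y Q) → Decides (⟦ andᵀ ⟧ γ x y) (P × Q)
  decides-×-given (inj₁ (p , refl)) decides with decides p
  ... | inj₁ (q , refl)  = inj₁ ((p , q) , refl)
  ... | inj₂ (¬q , refl) = inj₂ (¬q ∘ proj₂ , refl)
  decides-×-given (inj₂ (¬p , refl)) _ = inj₂ (¬p ∘ proj₁ , refl)

  decides-× : Decides x P → Decides y Q → Decides (⟦ andᵀ ⟧ γ x y) (P × Q)
  decides-× {γ = γ} p q = decides-×-given {γ = γ} p λ _ → q

  orᵀ : Closed (nat ⇒ nat ⇒ nat)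
  orᵀ = lam (lam (if v1 then one else v0 end))

  decides-⊎ : Decides x P → Decides y Q → Decides (⟦ orᵀ ⟧ γ x y) (P ⊎ Q)
  decides-⊎ (inj₁ (p , refl))  _                  = inj₁ (inj₁ p , refl)
  decides-⊎ (inj₂ (¬p , refl)) (inj₁ (q , refl))  = inj₁ (inj₂ q , refl)
  decides-⊎ (inj₂ (¬p , refl)) (inj₂ (¬q , refl)) = inj₂ (Sum.[ ¬p , ¬q ] , refl)

  not≡ : ∀ {b} → x ≡ bit b → ⟦ notᵀ ⟧ γ x ≡ bit (not b)
  not≡ {b = false} refl = refl
  not≡ {b = true}  refl = refl

  and≡ : ∀ {b c} → x ≡ bit b → y ≡ bit c → ⟦ andᵀ ⟧ γ x y ≡ bit (b ∧ c)
  and≡ {b = false} refl refl = refl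
  and≡ {b = true}  refl refl = refl

  or≡ : ∀ {b c} → x ≡ bit b → y ≡ bit c → ⟦ orᵀ ⟧ γ x y ≡ bit (b ∨ c)
  or≡ {b = false} refl refl = refl
  or≡ {b = true}  refl refl = refl

opaque
  posᵀ : Closed (nat ⇒ nat)
  posᵀ = lam (rec ze (lam (lam one)) v0)

  decides-pos : x ≡ m → Decides (⟦ posᵀ ⟧ γ x) (0 < m)
  decides-pos {m = zero}  refl = inj₂ ((λ ()) , refl)
  decides-pos {m = suc m} refl = inj₁ (s≤s z≤n , refl)

opaque
  eqᵀ : Closed (nat ⇒ nat ⇒ nat)
  eqᵀ = lam (rec (lam (notᵀ ∙ (posᵀ ∙ v0)))
                 (lam (lam (lam (andᵀ ∙ (posᵀ ∙ v0) ∙ (v1 ∙ (predᵀ ∙ v0)))))) v0)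

  decides-≡ : x ≡ m → y ≡ n → Decides (⟦ eqᵀ ⟧ γ x y) (m ≡ n)
  decides-≡ {m = m} {n = n} refl refl =
    primRec-induction {A = ℕ → ℕ} (λ m f → ∀ n → Decides (f n) (m ≡ n))
      (λ n → decides-map (0≮n⇔0≡n n) (decides-¬ (decides-pos refl)))
      (λ {k} {f} IH n → decides-map (suc≡⇔ n) (decides-× (decides-pos refl)
        (subst (λ v → Decides (f v) (k ≡ pred n)) (sym (pred≡ refl)) (IH (pred n))))) m n
    where
    0≮n⇔0≡n : ∀ n → (¬ 0 < n) ⇔ (0 ≡ n)
    0≮n⇔0≡n zero    = mk⇔ (λ _ → refl) (λ _ ())
    0≮n⇔0≡n (suc n) = mk⇔ (λ ≮ → contradiction (s≤s z≤n) ≮) (λ ())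
    suc≡⇔ : ∀ {k} n → (0 < n × k ≡ pred n) ⇔ (suc k ≡ n)
    suc≡⇔ zero    = mk⇔ (λ { (() , _) }) (λ ())
    suc≡⇔ (suc n) = mk⇔ (λ { (_ , refl) → refl }) (λ { refl → s≤s z≤n , refl })

opaque
  unpairᵀ : Closed (nat ⇒ nat ⊗ nat)
  unpairᵀ = lam (rec (pair ze ze)
    (lam (lam (if posᵀ ∙ (fst v0)
               then pair (predᵀ ∙ (fst v0)) (su (snd v0))
               else pair (su (snd v0)) ze end))) v0)

  unpair≡ : x ≡ m → ⟦ unpairᵀ ⟧ γ x ≡ unpair m
  unpair≡ {m = m} refl = primRec-unique unpair refl
    (λ k → if-elim (_≡ unpair (suc k)) (decides-pos refl) (pos _ _) (zer _ _)) m
    where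
    pos : ∀ a b → 0 < a → (⟦ predᵀ ⟧ γ a , suc b) ≡ unpairStep (a , b)
    pos (suc a) b _ = cong (_, suc b) (pred≡ refl)
    zer : ∀ a b → ¬ 0 < a → (suc b , 0) ≡ unpairStep (a , b)
    zer zero    b _ = refl
    zer (suc a) b ≮ = contradiction (s≤s z≤n) ≮

  π₁ᵀ π₂ᵀ : Closed (nat ⇒ nat)
  π₁ᵀ = lam (fst (unpairᵀ ∙ v0))
  π₂ᵀ = lam (snd (unpairᵀ ∙ v0))

  π₁≡ : x ≡ m → ⟦ π₁ᵀ ⟧ γ x ≡ π₁ m
  π₁≡ p = cong proj₁ (unpair≡ p)

  π₂≡ : x ≡ m → ⟦ π₂ᵀ ⟧ γ x ≡ π₂ m
  π₂≡ p = cong proj₂ (unpair≡ p)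

  pair-π₁≡ : x ≡ ⟨ m , n ⟩ → ⟦ π₁ᵀ ⟧ γ x ≡ m
  pair-π₁≡ {m = m} {n = n} p = trans (π₁≡ p) (π₁-pair m n)

  pair-π₂≡ : x ≡ ⟨ m , n ⟩ → ⟦ π₂ᵀ ⟧ γ x ≡ n
  pair-π₂≡ {m = m} {n = n} p = trans (π₂≡ p) (π₂-pair m n)

-- Division, and sets of states as binary numerals

opaque
  divModᵀ : Closed (nat ⇒ nat ⇒ nat ⊗ nat)
  divModᵀ = lam (lam (rec (pair ze ze)
    (lam (lam (if eqᵀ ∙ su (snd v0) ∙ v3
               then pair (su (fst v0)) ze
               else pair (fst v0) (su (snd v0)) end))) v0))

  divMod-spec : ∀ z → 0 < m → let q , r = ⟦ divModᵀ ⟧ γ m z in q * m + r ≡ z × r < m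
  divMod-spec {m = m} z 0<m = primRec-induction {A = ℕ × ℕ}
    (λ z qr → proj₁ qr * m + proj₂ qr ≡ z × proj₂ qr < m) (refl , 0<m)
    (λ { {k} {q , r} (eq , r<m) →
      if-elim (λ qr → proj₁ qr * m + proj₂ qr ≡ suc k × proj₂ qr < m) (decides-≡ refl refl)
        (λ r≡m → carry-over q r r≡m eq , 0<m)
        (λ r≢m → trans (+-suc _ r) (cong suc eq) , ≤∧≢⇒< r<m r≢m) }) z
    where
    carry-over : ∀ q r → suc r ≡ m → q * m + r ≡ k → suc q * m + 0 ≡ suc k
    carry-over {k} q r refl eq = begin
      suc q * m + 0     ≡⟨ +-identityʳ _ ⟩
      suc r + q * m     ≡⟨ +-comm (suc r) (q * m) ⟩
      q * m + suc r     ≡⟨ +-suc (q * m) r ⟩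
      suc (q * m + r)   ≡⟨ cong suc eq ⟩
      suc k             ∎
      where open ≡-Reasoning

  quoᵀ remᵀ : Closed (nat ⇒ nat ⇒ nat)
  quoᵀ = lam (lam (fst (divModᵀ ∙ v1 ∙ v0)))
  remᵀ = lam (lam (snd (divModᵀ ∙ v1 ∙ v0)))

  quo-rem-unique : ∀ q r → y ≡ q * m + r → r < m →
                   ⟦ quoᵀ ⟧ γ m y ≡ q × ⟦ remᵀ ⟧ γ m y ≡ r
  quo-rem-unique {y = y} q r y≡ r<m =
    let eq , r′<m = divMod-spec y (≤-<-trans z≤n r<m)
    in quotient-remainder-unique r′<m r<m (trans eq y≡)

private
  fin-decomposition : ∀ {k} n (i : Fin (k * n)) →
    toℕ i ≡ toℕ (quotient {k} n i) * n + toℕ (remainder {k} n i)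
  fin-decomposition {k} n i = begin
    toℕ i                      ≡⟨ cong toℕ (Fin.combine-remQuot {k} n i) ⟨
    toℕ (combine q r)          ≡⟨ Fin.toℕ-combine q r ⟩
    n * toℕ q + toℕ r          ≡⟨ cong (_+ toℕ r) (*-comm n (toℕ q)) ⟩
    toℕ q * n + toℕ r          ∎
    where
    open ≡-Reasoning
    q = quotient {k} n i
    r = remainder {k} n i

quotient≡ : ∀ {k n} (i : Fin (k * n)) → x ≡ n → y ≡ toℕ i →
            ⟦ quoᵀ ⟧ γ x y ≡ toℕ (quotient {k} n i)
quotient≡ {k = k} {n} i refl refl =
  proj₁ (quo-rem-unique _ _ (fin-decomposition {k} n i) (Fin.toℕ<n _))

remainder≡ : ∀ {k n} (i : Fin (k * n)) → x ≡ n → y ≡ toℕ i →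
             ⟦ remᵀ ⟧ γ x y ≡ toℕ (remainder {k} n i)
remainder≡ {k = k} {n} i refl refl =
  proj₂ (quo-rem-unique (toℕ (quotient {k} n i)) _ (fin-decomposition {k} n i) (Fin.toℕ<n _))

opaque
  combineᵀ : Closed (nat ⇒ nat ⇒ nat ⇒ nat)
  combineᵀ = lam (lam (lam (addᵀ ∙ (mulᵀ ∙ v2 ∙ v1) ∙ v0)))

  combine≡ : ∀ {k n z} {i : Fin k} {j : Fin n} → x ≡ n → y ≡ toℕ i → z ≡ toℕ j →
             ⟦ combineᵀ ⟧ γ x y z ≡ toℕ (combine i j)
  combine≡ {i = i} {j} p q r = trans (add≡ (mul≡ p q) r) (sym (Fin.toℕ-combine i j))

opaque
  halfᵀ parityᵀ : Closed (nat ⇒ nat)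
  halfᵀ   = lam (quoᵀ ∙ su one ∙ v0)
  parityᵀ = lam (remᵀ ∙ su one ∙ v0)

  half≡ : x ≡ m → ⟦ halfᵀ ⟧ γ x ≡ ⌊ m /2⌋
  half≡ {m = m} refl = proj₁ (quo-rem-unique _ _ (halves m) (m%n<n m 2))

  parity≡ : x ≡ m → ⟦ parityᵀ ⟧ γ x ≡ m % 2
  parity≡ {m = m} refl = proj₂ (quo-rem-unique ⌊ m /2⌋ _ (halves m) (m%n<n m 2))

opaque
  -- `finToFun` reads a subset number as `N` binary digits, the most significant one belonging to
  -- element 0. Hence the leading digit is a quotient by a power of two, and the other elements live
  -- in the remainder.
  memberᵀ : Closed (nat ⇒ nat ⇒ nat ⇒ nat)
  memberᵀ = lam (rec (lam (lam ze))
    (lam (lam (lam (lam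
      (if posᵀ ∙ v0
       then v2 ∙ (remᵀ ∙ (pow2ᵀ ∙ v3) ∙ v1) ∙ (predᵀ ∙ v0)
       else quoᵀ ∙ (pow2ᵀ ∙ v3) ∙ v1 end))))) v0)

  member≡ : ∀ {N} (S : Subset N) (q : Fin N) →
            ⟦ memberᵀ ⟧ γ N (toℕ S) (toℕ q) ≡ toℕ (finToFun S q)
  member≡ {N = N} S q = primRec-induction {A = ℕ → ℕ → ℕ}
    (λ N f → ∀ S q → f (toℕ S) (toℕ q) ≡ toℕ (finToFun {2} {N} S q))
    (λ S ())
    (λ { {N} IH S zero → if-elim (_≡ toℕ (quotient (2 ^ N) S)) (decides-pos refl) (λ ()) λ _ →
           quotient≡ S (pow2≡ refl) refl
       ; {N} {f} IH S (suc q) → let R = remainder {2} (2 ^ N) S in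
           if-elim (_≡ toℕ (finToFun {2} {N} R q)) (decides-pos refl)
             (λ _ → trans (cong₂ f (remainder≡ {k = 2} S (pow2≡ refl) refl) (pred≡ refl)) (IH R q))
             (λ ≮ → contradiction (s≤s z≤n) ≮) })
    N S q

  comprehensionᵀ : Closed (nat ⇒ (nat ⇒ nat) ⇒ nat)
  comprehensionᵀ = lam (rec (lam ze)
    (lam (lam (lam (combineᵀ ∙ (pow2ᵀ ∙ v2) ∙ (v0 ∙ ze) ∙ (v1 ∙ lam (v1 ∙ su v0)))))) v0)

  funToFin≡ : ∀ {N} {f : ℕ → ℕ} {g : Fin N → Fin 2} → x ≡ N → (∀ i → f (toℕ i) ≡ toℕ (g i)) →
              ⟦ comprehensionᵀ ⟧ γ x f ≡ toℕ (funToFin g)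
  funToFin≡ {x = x} refl f≡g = primRec-induction {A = (ℕ → ℕ) → ℕ}
    (λ N r → ∀ f (g : Fin N → Fin 2) → (∀ i → f (toℕ i) ≡ toℕ (g i)) → r f ≡ toℕ (funToFin g))
    (λ _ _ _ → refl)
    (λ IH f g f≡g → combine≡ {i = g zero} (pow2≡ refl) (f≡g zero) (IH _ (g ∘ suc) (f≡g ∘ suc)))
    x _ _ f≡g

comprehension≡ : ∀ {N} {f : ℕ → ℕ} {P : Pred (Fin N) 0ℓ} (P? : ∀ q → Dec (P q)) → x ≡ N →
                 (∀ q → Decides (f (toℕ q)) (P q)) →
                 ⟦ comprehensionᵀ ⟧ γ x f ≡ toℕ (comprehension P?)
comprehension≡ P? x≡N decides = funToFin≡ x≡N λ q → decided (P? q) (decides q)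
  where
  decided : (P? : Dec P) → Decides x P → x ≡ toℕ {2} (if does P? then suc zero else zero)
  decided (yes _) (inj₁ (_ , eq))  = eq
  decided (yes p) (inj₂ (¬p , _))  = contradiction p ¬p
  decided (no ¬p) (inj₁ (p , _))   = contradiction p ¬p
  decided (no _)  (inj₂ (_ , eq))  = eq

member-decides : ∀ {N} (S : Subset N) (q : Fin N) → x ≡ N → y ≡ toℕ S →
                 Decides (⟦ memberᵀ ⟧ γ x y (toℕ q)) (S ∋ q)
member-decides {γ = γ} {N} S q refl refl with finToFun S q | member≡ {γ = γ} S q
... | zero     | eq = inj₂ ((λ ()) , eq)
... | suc zero | eq = inj₁ (refl , eq)

opaque
  existsᵀ : Closed (nat ⇒ (nat ⇒ nat) ⇒ nat)
  existsᵀ = lam (lam (rec ze (lam (lam (orᵀ ∙ (v2 ∙ v1) ∙ v0))) v1))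

  decides-∃< : ∀ {f : ℕ → ℕ} {P : ℕ → Set} → x ≡ n → (∀ i → i < n → Decides (f i) (P i)) →
               Decides (⟦ existsᵀ ⟧ γ x f) (∃ λ i → i < n × P i)
  decides-∃< {n = n} {f = f} {P} refl = primRec-induction {A = ℕ}
    (λ n r → (∀ i → i < n → Decides (f i) (P i)) → Decides r (∃ λ i → i < n × P i))
    (λ _ → inj₂ ((λ { (_ , () , _) }) , refl))
    (λ {k} IH decides → decides-map (mk⇔ (λ
        { (inj₁ Pk) → k , ≤-refl , Pk
        ; (inj₂ (i , i<k , Pi)) → i , m<n⇒m<1+n i<k , Pi })
      (λ { (i , i<1+k , Pi) → case m<1+n⇒m<n∨m≡n i<1+k of λ
        { (inj₁ i<k) → inj₂ (i , i<k , Pi) ; (inj₂ refl) → inj₁ Pi } }))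
      (decides-⊎ (decides k ≤-refl) (IH λ i → decides i ∘ m<n⇒m<1+n)))
    n

decides-∃Fin : ∀ {f : ℕ → ℕ} {P : Fin n → Set} → x ≡ n → (∀ i → Decides (f (toℕ i)) (P i)) →
               Decides (⟦ existsᵀ ⟧ γ x f) (∃ P)
decides-∃Fin {n} {f = f} {P = P} x≡n decides =
  decides-map (mk⇔ (λ { (_ , i<n , Pi) → _ , Pi i<n })
                   (λ { (i , Pi) → toℕ i , Fin.toℕ<n i , λ lt → subst P (sym (Fin.fromℕ<-toℕ i lt)) Pi }))
    -- A predicate on `Fin n` becomes one on numbers by ranging over all proofs of the bound; any
    -- two such proofs give the same element.
    (decides-∃< {P = λ i → (i<n : i < n) → P (Fin.fromℕ< i<n)} x≡n λ i i<n →
      decides-map (mk⇔ (λ Pi lt → subst P (Fin.fromℕ<-cong _ _ refl i<n lt) Pi) (λ Pi → Pi i<n))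
        (subst (λ j → Decides (f j) (P (Fin.fromℕ< i<n))) (Fin.toℕ-fromℕ< i<n) (decides (Fin.fromℕ< i<n))))

opaque
  forallᵀ : Closed (nat ⇒ (nat ⇒ nat) ⇒ nat)
  forallᵀ = lam (lam (notᵀ ∙ (existsᵀ ∙ v1 ∙ lam (notᵀ ∙ (v1 ∙ v0)))))

  decides-∀< : ∀ {f : ℕ → ℕ} {P : ℕ → Set} → x ≡ n → (∀ i → i < n → Decides (f i) (P i)) →
               Decides (⟦ forallᵀ ⟧ γ x f) (∀ i → i < n → P i)
  decides-∀< {f = f} {P} x≡n decides = decides-map
    (mk⇔ (λ ∄ i i<n → decidable-stable (decides⇒dec (decides i i<n)) (λ ¬Pi → ∄ (i , i<n , ¬Pi)))
         (λ { ∀P (i , i<n , ¬Pi) → ¬Pi (∀P i i<n) }))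
    (decides-¬ (decides-∃< x≡n λ i i<n → decides-¬ (decides i i<n)))

-- The branches enter as arguments of a closed selector, which spares weakening them. Tags beyond
-- the list get an arbitrary value, so the selection is total at every type.
cases : List (Tm Γ σ) → Tm Γ (nat ⇒ σ)
cases {σ = σ} []       = lam (arbitrary σ)
  where
  arbitrary : ∀ σ → Tm Γ σ
  arbitrary nat     = ze
  arbitrary (σ ⇒ τ) = lam (arbitrary τ)
  arbitrary (σ ⊗ τ) = pair (arbitrary σ) (arbitrary τ)
cases (t ∷ ts) = lam (lam (lam (rec v2 (lam (lam (v3 ∙ v1))) v0))) ∙ t ∙ cases ts

-- A syntax tree is coded by its tag and an argument; the step has access to
-- the values at all smaller numbers, in particular at the subtrees.

opaque
  foldᵀ : Closed ((nat ⇒ nat ⇒ (nat ⇒ σ) ⇒ σ) ⇒ nat ⇒ σ)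
  foldᵀ = lam (lam (rec (cases []) (lam (lam (lam (v4 ∙ (π₁ᵀ ∙ v0) ∙ (π₂ᵀ ∙ v0) ∙ v1)))) (su v0) ∙ v0))

  -- Course-of-values recursion: after `k` rounds, starting from arbitrary values, the table is
  -- right at all codes below `k`, so `suc (code i)` rounds are enough for `i`. The hypothesis
  -- treats each `i` separately, so one value may serve several trees with the same code.
  fold-induction : ∀ {s} {I : Set} (code : I → ℕ) (R : I → ⟦ σ ⟧ty → Set) →
    (∀ f i → (∀ {j x} → x ≡ code j → code j < code i → R j (f x)) →
      ∃₂ λ a b → code i ≡ ⟨ a , b ⟩ × R i (s a b f)) →
    ∀ {x i} → x ≡ code i → R i (⟦ foldᵀ {σ} ⟧ γ s x)
  fold-induction {σ} {s = s} code R Rs {i = i} refl = primRec-induction {A = ℕ → ⟦ σ ⟧ty}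
    (λ k f → ∀ x → x < k → ∀ i → x ≡ code i → R i (f x))
    (λ _ ())
    (λ {k} {f} IH x x≤k i x≡ →
      let a , b , eq , r = Rs f i λ { {j} {y} y≡ j<i →
            IH y (<-≤-trans (subst₂ _<_ (sym y≡) (sym x≡) j<i) (s≤s⁻¹ x≤k)) j y≡ }
      in subst₂ (λ a b → R i (s a b f)) (sym (pair-π₁≡ {n = b} (trans x≡ eq)))
                                        (sym (pair-π₂≡ {m = a} (trans x≡ eq))) r)
    (suc (code i)) (code i) ≤-refl i refl

opaque
  headᵀ tailᵀ : Closed (nat ⇒ nat)
  headᵀ = lam (π₁ᵀ ∙ (predᵀ ∙ v0))
  tailᵀ = lam (π₂ᵀ ∙ (predᵀ ∙ v0))

  head≡ : x ≡ m → ⟦ headᵀ ⟧ γ x ≡ π₁ (pred m)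
  head≡ {m = m} p = π₁≡ {m = pred m} (pred≡ p)

  tail≡ : x ≡ m → ⟦ tailᵀ ⟧ γ x ≡ π₂ (pred m)
  tail≡ {m = m} p = π₂≡ {m = pred m} (pred≡ p)

opaque
  nthᵀ : Closed (nat ⇒ nat ⇒ nat)
  nthᵀ = lam (rec headᵀ (lam (lam (lam (v1 ∙ (tailᵀ ∙ v0))))) v0)

  nth≡ : ∀ {A : Set} (g : A → ℕ) (v : Vec A n) (i : Fin n) → x ≡ toℕ i →
         y ≡ codeList (List.map g (Vec.toList v)) → ⟦ nthᵀ ⟧ γ x y ≡ g (lookup v i)
  nth≡ {A = A} g v i refl y≡ = primRec-induction {A = ℕ → ℕ}
    (λ m f → ∀ {n} (v : Vec A n) (i : Fin n) {y} → m ≡ toℕ i →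
             y ≡ codeList (List.map g (Vec.toList v)) → f y ≡ g (lookup v i))
    (λ { (a ∷ v) zero _ y≡ → trans (head≡ y≡) (π₁-pair (g a) _) ; (a ∷ v) (suc i) () })
    (λ { IH (a ∷ v) zero () ; IH (a ∷ v) (suc i) eq y≡ →
         IH v i (suc-injective eq) (trans (tail≡ y≡) (π₂-pair (g a) _)) })
    (toℕ i) v i refl y≡

-- Values of programs and unbounded search

⇓-functional : ∀ c → c ⟨ x ⟩⇓ m → c ⟨ x ⟩⇓ n → m ≡ n
⇓-functional c (k , ck , below-k) (l , cl , below-l) with <-cmp k l
... | tri< k<l _ _ = contradiction (trans (sym ck) (below-l k k<l)) λ ()
... | tri≈ _ refl _ = suc-injective (trans (sym ck) cl)
... | tri> _ _ l<k = contradiction (trans (sym cl) (below-k l l<k)) λ ()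

-- The stage is ignored, so the answer is already there at stage 0.
compute : Closed (nat ⇒ nat) → Program
compute f = lam (lam (su (f ∙ v1)))

compute⇓ : (f : Closed (nat ⇒ nat)) → (∀ {Γ} {γ : Env Γ} → ⟦ f ⟧ γ x ≡ m) → compute f ⟨ x ⟩⇓ m
compute⇓ f fx≡m = 0 , cong suc fx≡m , λ _ ()

decide-answers : (f : Closed (nat ⇒ nat)) → (∀ {Γ} {γ : Env Γ} → Decides (⟦ f ⟧ γ x) P) →
                 Answers (compute f) x P
decide-answers {x} f decides with decides {nat ∷ nat ∷ []} {0 ∷ x ∷ []}
... | inj₁ (p , eq)  = inj₁ (p , 0 , cong suc eq , λ _ ())
... | inj₂ (¬p , eq) = inj₂ (¬p , 0 , cong suc eq , λ _ ())

-- The stage number doubles as the candidate, so the first stage with an output yields the least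
-- candidate that passes the test.
search : Closed (nat ⇒ nat) → Program
search f = lam (lam (if f ∙ (pairᵀ ∙ v1 ∙ v0) then su v0 else ze end))

least : ∀ {P : ℕ → Set} → (∀ k → Dec (P k)) → ∃ P → ∃ λ k → P k × (∀ j → j < k → ¬ P j)
least {P} P? (n , Pn) with anyUpTo? P? n
... | no none = n , Pn , λ j j<n Pj → none (j , j<n , Pj)
... | yes below = go n below
  where
  go : ∀ n → (∃ λ k → k < n × P k) → ∃ λ k → P k × (∀ j → j < k → ¬ P j)
  go (suc n) (k , k≤n , Pk) with anyUpTo? P? k
  ... | no none = k , Pk , λ j j<k Pj → none (j , j<k , Pj)
  ... | yes (j , j<k , Pj) = go n (j , <-≤-trans j<k (s≤s⁻¹ k≤n) , Pj)

search⇓ : ∀ {P : ℕ → Set} (f : Closed (nat ⇒ nat)) →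
          (∀ k {Γ} {γ : Env Γ} → Decides (⟦ f ⟧ γ ⟨ x , k ⟩) (P k)) →
          ∃ P → ∃ λ k → search f ⟨ x ⟩⇓ k × P k
search⇓ {x} {P} f decides ∃P =
  let k , Pk , minimal = least (λ k → decides⇒dec (decides k {[]} {[]})) ∃P
  in k , (k , stage k (_≡ suc k) (λ _ → refl) (contradiction Pk) ,
          λ j j<k → stage j (_≡ 0) (λ Pj → contradiction Pj (minimal j j<k)) (λ _ → refl)) , Pk
  where
  stage : ∀ k (R : ℕ → Set) → (P k → R (suc k)) → (¬ P k → R 0) → R (⟦ search f ⟧ [] x k)
  stage k R = if-elim R (subst (λ w → Decides (⟦ f ⟧ (k ∷ x ∷ []) w) (P k)) (sym (pair≡ refl refl)) (decides k))

-- Automata as values of System T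

Letter TermTy Aut : Ty
Letter = nat ⇒ nat
TermTy = nat ⊗ nat ⊗ (Letter ⇒ nat)
Aut    = nat ⊗ nat ⊗ (nat ⇒ Letter ⇒ nat) ⊗ (nat ⇒ nat)

infix 4 _≈_

-- Letters are functions from track numbers to bits, unconstrained beyond the last track. One type
-- therefore serves every `n`, and `lam ze` is the zero letter for any number of tracks.
_≈_ : (ℕ → ℕ) → Vec Bool n → Set
β ≈ b = ∀ i → β (toℕ i) ≡ bit (lookup b i)

record RepresentsTerm {n} (v : ⟦ TermTy ⟧ty) (t : Term n) : Set where
  constructor represents
  field
    constant≡ : proj₁ v ≡ constant t
    weight≡   : proj₁ (proj₂ v) ≡ weight t
    linear≡   : ∀ {β b} → β ≈ b → proj₂ (proj₂ v) β ≡ linear t b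

open RepresentsTerm

-- Only the behaviour on numbers of states is prescribed. Taking `x ≡ toℕ q` as a hypothesis lets
-- state numbers computed by opaque programs be plugged in directly.
record Represents {n} (v : ⟦ Aut ⟧ty) (A : DFA n) : Set where
  constructor represents
  field
    size≡  : proj₁ v ≡ size A
    start≡ : proj₁ (proj₂ v) ≡ toℕ (start A)
    step≡  : ∀ {q x β b} → x ≡ toℕ q → β ≈ b →
             proj₁ (proj₂ (proj₂ v)) x β ≡ toℕ (step A q b)
    final≡ : ∀ {q x} → x ≡ toℕ q → proj₂ (proj₂ (proj₂ v)) x ≡ bit (final A q)

open Represents

sizeᵀ startᵀ : Tm Γ Aut → Tm Γ nat
sizeᵀ A  = fst A
startᵀ A = fst (snd A)

stepᵀ : Tm Γ Aut → Tm Γ (nat ⇒ Letter ⇒ nat)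
stepᵀ A = fst (snd (snd A))

finalᵀ : Tm Γ Aut → Tm Γ (nat ⇒ nat)
finalᵀ A = snd (snd (snd A))

if-≡ : ∀ {n t e} {t′ e′ : Fin n} → Decides x P → (P? : Dec P) → t ≡ toℕ t′ → e ≡ toℕ e′ →
       ⟦ ifᵀ {nat} ⟧ γ x t e ≡ toℕ (if does P? then t′ else e′)
if-≡ decides (yes p) t≡ e≡ = if-elim (_≡ _) decides (λ _ → t≡) (contradiction p)
if-≡ decides (no ¬p) t≡ e≡ = if-elim (_≡ _) decides (λ p → contradiction p ¬p) (λ _ → e≡)

opaque
  termᵀ : Closed (nat ⇒ TermTy)
  termᵀ = foldᵀ ∙ lam (lam (lam (cases
    ( pair ze (pair one (lam (v0 ∙ v2)))
    ∷ pair ze (pair ze (lam ze))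
    ∷ pair one (pair one (lam ze))
    ∷ (lam (lam (pair (addᵀ ∙ fst v1 ∙ fst v0)
                (pair (addᵀ ∙ fst (snd v1) ∙ fst (snd v0))
                      (lam (addᵀ ∙ (snd (snd v2) ∙ v0) ∙ (snd (snd v1) ∙ v0))))))
       ∙ (v0 ∙ (π₁ᵀ ∙ v1)) ∙ (v0 ∙ (π₂ᵀ ∙ v1)))
    ∷ []) ∙ v2)))

  term-represents : {t : Term n} → x ≡ codeTerm t → RepresentsTerm (⟦ termᵀ ⟧ γ x) t
  term-represents = fold-induction codeTerm (λ t v → RepresentsTerm v t) λ where
    f (var i) IH → 0 , toℕ i , refl , represents refl refl (λ β≈b → β≈b i)
    f 𝟘       IH → 1 , 0 , refl , represents refl refl (λ _ → refl)
    f 𝟙       IH → 2 , 0 , refl , represents refl refl (λ _ → refl)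
    f (s ⊕ t) IH →
      let c = codeTerm s
          d = codeTerm t
          S = IH {s} (pair-π₁≡ {n = d} refl) (left<node 2 c d)
          R = IH {t} (pair-π₂≡ {m = c} refl) (right<node 2 c d)
      in 3 , ⟨ c , d ⟩ , refl ,
         represents (add≡ (constant≡ S) (constant≡ R)) (add≡ (weight≡ S) (weight≡ R))
                    (λ β≈b → add≡ (linear≡ S β≈b) (linear≡ R β≈b))

opaque
  equalityᵀ : Closed (TermTy ⇒ TermTy ⇒ Aut)
  equalityᵀ = lam (lam
    (pair (su (mulᵀ ∙ su (weightᵀ v1) ∙ su (weightᵀ v0)))
    (pair (su (combineᵀ ∙ su (weightᵀ v0) ∙ constantᵀ v1 ∙ constantᵀ v0))
    (pair (lam (lam
      (if posᵀ ∙ v1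
       then lam (lam
         (if eqᵀ ∙ (parityᵀ ∙ v1) ∙ (parityᵀ ∙ v0)
          then su (combineᵀ ∙ su (weightᵀ v4) ∙ (halfᵀ ∙ v1) ∙ (halfᵀ ∙ v0))
          else ze end))
         ∙ (addᵀ ∙ (quoᵀ ∙ su (weightᵀ v2) ∙ (predᵀ ∙ v1)) ∙ (linearᵀ v3 ∙ v0))
         ∙ (addᵀ ∙ (remᵀ ∙ su (weightᵀ v2) ∙ (predᵀ ∙ v1)) ∙ (linearᵀ v2 ∙ v0))
       else ze end)))
    (lam (andᵀ ∙ (posᵀ ∙ v0) ∙
      (eqᵀ ∙ (quoᵀ ∙ su (weightᵀ v1) ∙ (predᵀ ∙ v0)) ∙ (remᵀ ∙ su (weightᵀ v1) ∙ (predᵀ ∙ v0)))))))))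
    where
    constantᵀ weightᵀ : Tm Γ TermTy → Tm Γ nat
    constantᵀ t = fst t
    weightᵀ t   = fst (snd t)
    linearᵀ : Tm Γ TermTy → Tm Γ (Letter ⇒ nat)
    linearᵀ t   = snd (snd t)

  equality-represents : ∀ {u v} {s t : Term n} → RepresentsTerm u s → RepresentsTerm v t →
                        Represents (⟦ equalityᵀ ⟧ γ u v) (equality s t)
  equality-represents {n = n} {v = v} {s = s} {t} S R = represents
    (cong suc (mul≡ (cong suc (weight≡ S)) ws))
    (cong suc (combine≡ ws (trans (constant≡ S) (sym (Fin.toℕ-fromℕ< _)))
                           (trans (constant≡ R) (sym (Fin.toℕ-fromℕ< _)))))
    (λ { {zero} q≡ β≈b → if-elim (_≡ 0) (decides-pos q≡) (λ ()) (λ _ → refl)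
       ; {suc q} {b = b} q≡ β≈b →
         let l≡ = add≡ (left≡ q q≡) (linear≡ S β≈b)
             r≡ = add≡ (right≡ q q≡) (linear≡ R β≈b)
         in if-elim (_≡ toℕ (step (equality s t) (suc q) b)) (decides-pos q≡)
              (λ _ → if-≡ (decides-≡ (parity≡ l≡) (parity≡ r≡))
                 (total s (left q) b % 2 ≟ total t (right q) b % 2)
                 (cong suc (combine≡ ws (trans (half≡ l≡) (sym (Fin.toℕ-fromℕ< _)))
                                        (trans (half≡ r≡) (sym (Fin.toℕ-fromℕ< _)))))
                 refl)
              (contradiction (s≤s z≤n)) })
    -- In the dead state the guard `0 < 0` fails and masks the comparison of the carries, which are
    -- meaningless there.
    (λ { {zero} q≡ → decides⇒≡bit (decides-map (mk⇔ (λ { (() , _) }) (λ ()))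
           (decides-× {Q = _ ≡ _} (decides-pos q≡) (decides-≡ refl refl)))
       ; {suc q} q≡ → trans (and≡ {b = true} (decides-true (decides-pos q≡) (s≤s z≤n))
           (decides⇒bit (decides-≡ (left≡ q q≡) (right≡ q q≡)) (toℕ (left q) ≟ toℕ (right q)))) refl })
    where
    ws : 1 + proj₁ (proj₂ v) ≡ 1 + weight t
    ws = cong suc (weight≡ R)
    left : Fin (suc (weight s) * suc (weight t)) → Carry s
    left = quotient (suc (weight t))
    right : Fin (suc (weight s) * suc (weight t)) → Carry t
    right = remainder {suc (weight s)} (suc (weight t))
    left≡ : ∀ q {Γ} {γ : Env Γ} → x ≡ toℕ (suc q) →
            ⟦ quoᵀ ⟧ γ (suc (proj₁ (proj₂ v))) (⟦ predᵀ ⟧ γ x) ≡ toℕ (left q)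
    left≡ q q≡ = quotient≡ q ws (pred≡ q≡)
    right≡ : ∀ q {Γ} {γ : Env Γ} → x ≡ toℕ (suc q) →
            ⟦ remᵀ ⟧ γ (suc (proj₁ (proj₂ v))) (⟦ predᵀ ⟧ γ x) ≡ toℕ (right q)
    right≡ q q≡ = remainder≡ {k = suc (weight s)} q ws (pred≡ q≡)

opaque
  complementᵀ : Closed (Aut ⇒ Aut)
  complementᵀ = lam (pair (sizeᵀ v0) (pair (startᵀ v0) (pair (stepᵀ v0) (lam (notᵀ ∙ (finalᵀ v1 ∙ v0))))))

  complement-represents : ∀ {v} {A : DFA n} → Represents v A →
                          Represents (⟦ complementᵀ ⟧ γ v) (complement A)
  complement-represents V = represents (size≡ V) (start≡ V) (step≡ V) (λ q≡ → not≡ (final≡ V q≡))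

opaque
  productᵀ : Closed ((nat ⇒ nat ⇒ nat) ⇒ Aut ⇒ Aut ⇒ Aut)
  productᵀ = lam (lam (lam
    (pair (mulᵀ ∙ sizeᵀ v1 ∙ sizeᵀ v0)
    (pair (combineᵀ ∙ sizeᵀ v0 ∙ startᵀ v1 ∙ startᵀ v0)
    (pair (lam (lam (combineᵀ ∙ sizeᵀ v2 ∙ (stepᵀ v3 ∙ (quoᵀ ∙ sizeᵀ v2 ∙ v1) ∙ v0)
                                        ∙ (stepᵀ v2 ∙ (remᵀ ∙ sizeᵀ v2 ∙ v1) ∙ v0))))
    (lam (v3 ∙ (finalᵀ v2 ∙ (quoᵀ ∙ sizeᵀ v1 ∙ v0)) ∙ (finalᵀ v1 ∙ (remᵀ ∙ sizeᵀ v1 ∙ v0)))))))))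

  product-represents : ∀ {f : ℕ → ℕ → ℕ} {op u v} {A B : DFA n} →
    (∀ {x y b c} → x ≡ bit b → y ≡ bit c → f x y ≡ bit (op b c)) →
    Represents u A → Represents v B → Represents (⟦ productᵀ ⟧ γ f u v) (product op A B)
  product-represents {A = A} {B} op≡ U V = represents
    (mul≡ (size≡ U) (size≡ V))
    (combine≡ (size≡ V) (start≡ U) (start≡ V))
    (λ {q} q≡ β≈b → combine≡ (size≡ V) (step≡ U (quotient≡ q (size≡ V) q≡) β≈b)
                             (step≡ V (remainder≡ {k = size A} q (size≡ V) q≡) β≈b))
    (λ {q} q≡ → op≡ (final≡ U (quotient≡ q (size≡ V) q≡))
                    (final≡ V (remainder≡ {k = size A} q (size≡ V) q≡)))

opaque
  consᵀ : Closed (nat ⇒ Letter ⇒ Letter)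
  consᵀ = lam (lam (lam (if posᵀ ∙ v0 then v1 ∙ (predᵀ ∙ v0) else v2 end)))

  cons≈ : ∀ {β} {a} {b : Vec Bool n} → x ≡ bit a → β ≈ b → ⟦ consᵀ ⟧ γ x β ≈ (a ∷ b)
  cons≈ {a = a} x≡ β≈b zero = if-elim (_≡ bit a) (decides-pos refl) (λ ()) (λ _ → x≡)
  cons≈ {β = β} {b = b} x≡ β≈b (suc i) = if-elim (_≡ bit (lookup b i)) (decides-pos refl)
    (λ _ → trans (cong β (pred≡ refl)) (β≈b i)) (contradiction (s≤s z≤n))

zeros : ∀ n → Vec Bool n
zeros n = Vec.replicate n false

-- `move?`, `padded` and `final?` give names to local parts of `project` and unfold to the same
-- terms, so that the proofs below can refer to them.
move? : (A : DFA (suc n)) (S : Subset (size A)) (b : Vec Bool n) (q′ : Fin (size A)) →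
        Dec (∃ λ q → (S ∋ q) × (step A q (false ∷ b) ≡ q′ ⊎ step A q (true ∷ b) ≡ q′))
move? A S b q′ = Fin.any? λ q → (S ∋? q) ×-dec
  ((step A q (false ∷ b) Fin.≟ q′) ⊎-dec (step A q (true ∷ b) Fin.≟ q′))

padded : (A : DFA (suc n)) → Subset (size A) → ℕ → Subset (size A)
padded {n} A S = fold S (λ S′ → step (project A) S′ (zeros n))

final? : (A : DFA (suc n)) (S : Subset (size A)) →
         Dec (∃ λ (k : Fin (2 ^ size A)) → ∃ λ q → (padded A S (toℕ k) ∋ q) × final A q ≡ true)
final? A S = Fin.any? λ k → Fin.any? λ q → (padded A S (toℕ k) ∋? q) ×-dec (final A q Bool.≟ true)

decides-Fin≡ : ∀ {i j : Fin n} → x ≡ toℕ i → y ≡ toℕ j → Decides (⟦ eqᵀ ⟧ γ x y) (i ≡ j)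
decides-Fin≡ x≡ y≡ = decides-map (mk⇔ Fin.toℕ-injective (cong toℕ)) (decides-≡ x≡ y≡)

opaque
  moveᵀ : Closed (Aut ⇒ nat ⇒ Letter ⇒ nat)
  moveᵀ = lam (lam (lam (comprehensionᵀ ∙ sizeᵀ v2 ∙ lam (existsᵀ ∙ sizeᵀ v3 ∙ lam
    (andᵀ ∙ (memberᵀ ∙ sizeᵀ v4 ∙ v3 ∙ v0) ∙
      (orᵀ ∙ (eqᵀ ∙ (stepᵀ v4 ∙ v0 ∙ (consᵀ ∙ ze ∙ v2)) ∙ v1)
           ∙ (eqᵀ ∙ (stepᵀ v4 ∙ v0 ∙ (consᵀ ∙ one ∙ v2)) ∙ v1)))))))

  move≡ : ∀ {v β b} {A : DFA (suc n)} {S} → Represents v A → x ≡ toℕ S → β ≈ b →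
          ⟦ moveᵀ ⟧ γ v x β ≡ toℕ (step (project A) S b)
  move≡ {b = b} {A} {S} V x≡ β≈b = comprehension≡ (move? A S b) (size≡ V) λ q′ →
    decides-∃Fin (size≡ V) λ q → decides-× (member-decides S q (size≡ V) x≡)
      (decides-⊎ (decides-Fin≡ (step≡ V refl (cons≈ {a = false} refl β≈b)) refl)
                 (decides-Fin≡ (step≡ V refl (cons≈ {a = true} refl β≈b)) refl))

opaque
  projectᵀ : Closed (Aut ⇒ Aut)
  projectᵀ = lam
    (pair (pow2ᵀ ∙ sizeᵀ v0)
    (pair (comprehensionᵀ ∙ sizeᵀ v0 ∙ lam (eqᵀ ∙ v0 ∙ startᵀ v1))
    (pair (moveᵀ ∙ v0)
    (lam (existsᵀ ∙ (pow2ᵀ ∙ sizeᵀ v1) ∙ lam (existsᵀ ∙ sizeᵀ v2 ∙ lam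
      (andᵀ ∙ (memberᵀ ∙ sizeᵀ v3 ∙ (rec v2 (lam (lam (moveᵀ ∙ v5 ∙ v0 ∙ lam ze))) v1) ∙ v0)
            ∙ (finalᵀ v3 ∙ v0))))))))

  project-represents : ∀ {v} {A : DFA (suc n)} → Represents v A →
                       Represents (⟦ projectᵀ ⟧ γ v) (project A)
  project-represents {n = n} {v = v} {A} V = represents
    (pow2≡ (size≡ V))
    (comprehension≡ (λ q → q Fin.≟ start A) (size≡ V) (λ q → decides-Fin≡ refl (start≡ V)))
    (move≡ V)
    (λ {S} {x} S≡ → decides⇒bit
      (decides-∃Fin (pow2≡ (size≡ V)) λ k → decides-∃Fin (size≡ V) λ q →
        decides-× (member-decides (padded A S (toℕ k)) q (size≡ V) 
          (primRec-unique (λ k → toℕ (padded A S k)) S≡ (λ k → move≡ V refl zeros≈) (toℕ k)))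
                  (bit⇒decides (final≡ V refl)))
      (final? A S))
    where
    zeros≈ : (λ _ → 0) ≈ zeros n
    zeros≈ i = cong bit (sym (Vec.lookup-replicate i false))

impᵀ : Closed (nat ⇒ nat ⇒ nat)
impᵀ = lam (lam (orᵀ ∙ (notᵀ ∙ v1) ∙ v0))

opaque
  automatonᵀ : Closed (nat ⇒ Aut)
  automatonᵀ = foldᵀ ∙ lam (lam (lam (cases
    ( equalityᵀ ∙ (termᵀ ∙ (π₁ᵀ ∙ v1)) ∙ (termᵀ ∙ (π₂ᵀ ∙ v1))
    ∷ complementᵀ ∙ (v0 ∙ v1)
    ∷ productᵀ ∙ andᵀ ∙ (v0 ∙ (π₁ᵀ ∙ v1)) ∙ (v0 ∙ (π₂ᵀ ∙ v1))
    ∷ productᵀ ∙ orᵀ ∙ (v0 ∙ (π₁ᵀ ∙ v1)) ∙ (v0 ∙ (π₂ᵀ ∙ v1))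
    ∷ productᵀ ∙ impᵀ ∙ (v0 ∙ (π₁ᵀ ∙ v1)) ∙ (v0 ∙ (π₂ᵀ ∙ v1))
    ∷ complementᵀ ∙ (projectᵀ ∙ (complementᵀ ∙ (v0 ∙ v1)))
    ∷ projectᵀ ∙ (v0 ∙ v1)
    ∷ []) ∙ v2)))

  automaton-represents : {φ : Formula n} → x ≡ codeFormula φ →
                         Represents (⟦ automatonᵀ ⟧ γ x) (automaton φ)
  -- Quantifiers change the number of free variables, so the induction runs over formulas with any
  -- such number. The code does not record it: `𝟘 ≐ 𝟘` has the same code for every `n`, and the one
  -- computed value represents all its automata.
  automaton-represents {n = n} {φ = φ} x≡ = fold-induction code
    (λ (n , φ) v → Represents v (automaton φ)) (λ where
      f (_ , s ≐ t)    IH → 0 , ⟨ codeTerm s , codeTerm t ⟩ , refl , equality-represents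
        (term-represents (pair-π₁≡ {n = codeTerm t} refl)) (term-represents (pair-π₂≡ {m = codeTerm s} refl))
      f (_ , neg φ)    IH → 1 , codeFormula φ , refl , complement-represents (IH {_ , φ} refl (right<pair 0 _))
      f (_ , conj φ ψ) IH → 2 , ⟨ codeFormula φ , codeFormula ψ ⟩ , refl ,
        product-represents and≡ (left {f} 1 φ ψ (λ j → IH {j})) (right {f} 1 φ ψ (λ j → IH {j}))
      f (_ , disj φ ψ) IH → 3 , ⟨ codeFormula φ , codeFormula ψ ⟩ , refl ,
        product-represents or≡ (left {f} 2 φ ψ (λ j → IH {j})) (right {f} 2 φ ψ (λ j → IH {j}))
      f (_ , imp φ ψ)  IH → 4 , ⟨ codeFormula φ , codeFormula ψ ⟩ , refl ,
        product-represents (λ p q → or≡ (not≡ p) q) (left {f} 3 φ ψ (λ j → IH {j})) (right {f} 3 φ ψ (λ j → IH {j}))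
      f (_ , all φ)    IH → 5 , codeFormula φ , refl ,
        complement-represents (project-represents (complement-represents (IH {_ , φ} refl (right<pair 4 _))))
      f (_ , ex φ)     IH → 6 , codeFormula φ , refl , project-represents (IH {_ , φ} refl (right<pair 5 _)))
    {i = n , φ} x≡
    where
    code : ∃ Formula → ℕ
    code (n , φ) = codeFormula φ
    Below : ℕ → (ℕ → ⟦ Aut ⟧ty) → Set
    Below k f = ∀ (φ : ∃ Formula) {x} → x ≡ code φ → code φ < k → Represents (f x) (automaton (proj₂ φ))
    left : ∀ {f n Γ} {γ : Env Γ} t (φ ψ : Formula n) → Below ⟨ suc t , ⟨ codeFormula φ , codeFormula ψ ⟩ ⟩ f →
           Represents (f (⟦ π₁ᵀ ⟧ γ ⟨ codeFormula φ , codeFormula ψ ⟩)) (automaton φ)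
    left t φ ψ IH = IH (_ , φ) (pair-π₁≡ {n = codeFormula ψ} refl) (left<node t (codeFormula φ) (codeFormula ψ))
    right : ∀ {f n Γ} {γ : Env Γ} t (φ ψ : Formula n) → Below ⟨ suc t , ⟨ codeFormula φ , codeFormula ψ ⟩ ⟩ f →
            Represents (f (⟦ π₂ᵀ ⟧ γ ⟨ codeFormula φ , codeFormula ψ ⟩)) (automaton ψ)
    right t φ ψ IH = IH (_ , ψ) (pair-π₂≡ {m = codeFormula φ} refl) (right<node t (codeFormula φ) (codeFormula ψ))

-- Orbits in finite sets

-- The order of the quantifiers in `distinct` is that of the two nested bounded loops by which
-- `lassoᵀ` tests it.
record Lasso {A : Set} (s : ℕ → A) (μ π : ℕ) : Set where
  field
    positive : 0 < π
    closes   : s (μ + π) ≡ s μ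
    distinct : ∀ j → j < μ + π → ∀ i → i < j → s i ≢ s j

open Lasso

module Orbit {A : Set} (f : A → A) (x : A) where

  s : ℕ → A
  s = fold x f

  shift : ∀ {i j} → s i ≡ s j → ∀ k → s (k + i) ≡ s (k + j)
  shift eq zero    = eq
  shift eq (suc k) = cong f (shift eq k)

  periodic-from : ∀ {μ π} → 0 < π → s (μ + π) ≡ s μ → PeriodicFrom s μ π
  periodic-from {μ} {π} 0<π eq = 0<π , λ t μ≤t → begin
    s (t + π)               ≡⟨ cong (λ t → s (t + π)) (m∸n+n≡m μ≤t) ⟨
    s (t ∸ μ + μ + π)       ≡⟨ cong s (+-assoc (t ∸ μ) μ π) ⟩
    s (t ∸ μ + (μ + π))     ≡⟨ shift eq (t ∸ μ) ⟩
    s (t ∸ μ + μ)           ≡⟨ cong s (m∸n+n≡m μ≤t) ⟩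
    s t                     ∎
    where open ≡-Reasoning

  module _ {μ π} (L : Lasso s μ π) where

    -- The point at time t is the one at some time r on the lasso, and r is
    -- on its cycle unless r = t.
    reduce : ∀ t → ∃ λ r → r < μ + π × s t ≡ s r × (μ ≤ r ⊎ r ≡ t)
    reduce zero = 0 , <-≤-trans (positive L) (m≤n+m π μ) , refl , inj₂ refl
    reduce (suc t) with reduce t
    ... | r , r<ℓ , eq , cycle with suc r <? μ + π
    ...   | yes 1+r<ℓ = suc r , 1+r<ℓ , cong f eq , Sum.map (λ μ≤r → m≤n⇒m≤1+n μ≤r) (cong suc) cycle
    ...   | no 1+r≮ℓ = μ , m<m+n μ (positive L) ,
            trans (cong f eq) (trans (cong s (≤-antisym r<ℓ (≮⇒≥ 1+r≮ℓ))) (closes L)) , inj₁ ≤-refl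

    distinct′ : ∀ {i j} → i < j → j < μ + π → s j ≢ s i
    distinct′ i<j j<ℓ eq = distinct L _ j<ℓ _ i<j (sym eq)

    -- If `μ′ < μ`, then the time `r` to which `μ′ + π′` reduces lies beyond `μ′`, being either on
    -- the cycle or unreduced. By periodicity `r` and `μ′` would be two times on the lasso with the
    -- same point.
    transient-least : ∀ {μ′ π′} → PeriodicFrom s μ′ π′ → μ ≤ μ′
    transient-least {μ′} {π′} (0<π′ , periodic) = ≮⇒≥ λ μ′<μ →
      let r , r<ℓ , eq , cycle = reduce (μ′ + π′)
          μ′<r = Sum.[_,_]′ (<-≤-trans μ′<μ) (λ r≡ → subst (μ′ <_) (sym r≡) (m<m+n μ′ 0<π′)) cycle
      in distinct′ μ′<r r<ℓ (trans (sym eq) (periodic μ′ ≤-refl))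

    around : ∀ k → s (k * π + μ) ≡ s μ
    around zero    = refl
    around (suc k) = begin
      s (π + k * π + μ)      ≡⟨ cong s (+-assoc π (k * π) μ) ⟩
      s (π + (k * π + μ))    ≡⟨ shift (around k) π ⟩
      s (π + μ)              ≡⟨ cong s (+-comm π μ) ⟩
      s (μ + π)              ≡⟨ closes L ⟩
      s μ                    ∎
      where open ≡-Reasoning

    -- Go round the cycle `μ′` times: the time `μ′ * π + μ` is at least `μ′` because `π` is
    -- positive, so the period `π′` is in force there, and the point is `s μ`. Hence
    -- `s (μ + π′) ≡ s μ`, which distinctness forbids for `π′ < π`.
    period-least : ∀ {μ′ π′} → PeriodicFrom s μ′ π′ → π ≤ π′
    period-least {μ′} {π′} (0<π′ , periodic) = ≮⇒≥ λ π′<π →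
      distinct′ (m<m+n μ 0<π′) (+-monoʳ-< μ π′<π) (begin
        s (μ + π′)              ≡⟨ cong s (+-comm μ π′) ⟩
        s (π′ + μ)              ≡⟨ shift (around μ′) π′ ⟨
        s (π′ + (μ′ * π + μ))   ≡⟨ cong s (+-comm π′ _) ⟩
        s (μ′ * π + μ + π′)     ≡⟨ periodic _ (≤-trans (m≤m*n μ′ π {{>-nonZero (positive L)}}) (m≤m+n _ μ)) ⟩
        s (μ′ * π + μ)          ≡⟨ around μ′ ⟩
        s μ                     ∎)
      where open ≡-Reasoning

    lasso⇒transientPeriod : IsTransientPeriod s μ π
    lasso⇒transientPeriod = record
      { periodic = periodic-from (positive L) (closes L)
      ; least    = λ _ _ p → transient-least p , period-least p
      }

  module _ (_≟A_ : DecidableEquality A) {M} (A↣ : A ↣ Fin M) where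

    Distinct : ℕ → Set
    Distinct k = ∀ j → j < k → ∀ i → i < j → s i ≢ s j

    distinct⇒≤ : ∀ {k} → Distinct k → k ≤ M
    distinct⇒≤ {k} distinct = Fin.injective⇒≤ {f = λ i → Injection.to A↣ (s (toℕ i))} λ {i} {j} eq →
      let s≡ = Injection.injective A↣ eq in
      case <-cmp (toℕ i) (toℕ j) of λ where
        (tri< i<j _ _) → contradiction s≡ (distinct (toℕ j) (Fin.toℕ<n j) (toℕ i) i<j)
        (tri≈ _ i≡j _) → Fin.toℕ-injective i≡j
        (tri> _ _ j<i) → contradiction (sym s≡) (distinct (toℕ i) (Fin.toℕ<n i) (toℕ j) j<i)

    lasso : ∃₂ λ μ π → Lasso s μ π
    lasso = go (suc M) 0 (+-identityʳ _) λ _ ()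
      where
      -- The search stops at the first `k` whose point occurred before. The fuel would run out only
      -- at `k = suc M`, where distinctness contradicts the pigeonhole bound.
      go : ∀ fuel k → fuel + k ≡ suc M → Distinct k → ∃₂ λ μ π → Lasso s μ π
      go zero       k refl distinct = contradiction (distinct⇒≤ distinct) 1+n≰n
      go (suc fuel) k eq   distinct with anyUpTo? (λ i → s i ≟A s k) k
      ... | yes (μ , μ<k , s≡) = μ , k ∸ μ , record
        { positive = m<n⇒0<n∸m μ<k
        ; closes   = trans (cong s k≡) (sym s≡)
        ; distinct = λ j j<k → distinct j (subst (j <_) k≡ j<k)
        }
        where
        k≡ : μ + (k ∸ μ) ≡ k
        k≡ = m+[n∸m]≡n (<⇒≤ μ<k)
      ... | no new = go fuel (suc k) (trans (+-suc fuel k) eq) λ j j≤k i i<j s≡ →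
        case m<1+n⇒m<n∨m≡n j≤k of λ where
          (inj₁ j<k)  → distinct j j<k i i<j s≡
          (inj₂ refl) → new (i , i<j , s≡)

    -- Two pairs that are both componentwise least coincide, so the given pair is the one found by
    -- `lasso`.
    transientPeriod⇒lasso : ∀ {μ π} → IsTransientPeriod s μ π → Lasso s μ π
    transientPeriod⇒lasso {μ} {π} T =
      let μ′ , π′ , L = lasso
          T′ = lasso⇒transientPeriod L
          μ≤μ′ , π≤π′ = IsTransientPeriod.least T μ′ π′ (IsTransientPeriod.periodic T′)
          μ′≤μ , π′≤π = IsTransientPeriod.least T′ μ π (IsTransientPeriod.periodic T)
      in subst₂ (Lasso s) (≤-antisym μ′≤μ μ≤μ′) (≤-antisym π′≤π π≤π′) L

    lasso-bounded : ∀ {μ π} → Lasso s μ π → μ + π ≤ M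
    lasso-bounded L = distinct⇒≤ (distinct L)

    -- Serves twice: it bounds the padding letters in a projection, and the times at which a mark
    -- has to be looked for.
    revisits : ∀ t → ∃ λ r → r < M × s t ≡ s r
    revisits t =
      let μ , π , L = lasso
          r , r<ℓ , eq , _ = reduce L t
      in r , <-≤-trans r<ℓ (lasso-bounded L) , eq

-- Correctness of the automata

Word : ℕ → Set
Word n = List (Vec Bool n)

digit : Bool → ℕ → ℕ
digit b x = x * 2 + bit b

decode : Word n → Vec ℕ n
decode []      = Vec.replicate _ 0
decode (b ∷ w) = Vec.zipWith digit b (decode w)

run : (A : DFA n) → Fin (size A) → Word n → Fin (size A)
run A q []      = q
run A q (b ∷ w) = run A (step A q b) w

AcceptsFrom : (A : DFA n) → Fin (size A) → Word n → Set
AcceptsFrom A q w = final A (run A q w) ≡ true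

Accepts : DFA n → Word n → Set
Accepts A = AcceptsFrom A (start A)

accepts? : (A : DFA n) (w : Word n) → Dec (Accepts A w)
accepts? A w = final A (run A (start A) w) Bool.≟ true

-- Ranging over all words builds in that trailing zero letters are immaterial, since they do not
-- change `decode`.
Recognises : DFA n → (Vec ℕ n → Set) → Set
Recognises A P = ∀ w → Accepts A w ⇔ P (decode w)

linearPart : Term n → Vec ℕ n → ℕ
linearPart (var i) ρ = lookup ρ i
linearPart 𝟘       ρ = 0
linearPart 𝟙       ρ = 0
linearPart (s ⊕ t) ρ = linearPart s ρ + linearPart t ρ

value-split : (t : Term n) (ρ : Vec ℕ n) → value t ρ ≡ constant t + linearPart t ρ
value-split (var i) ρ = refl
value-split 𝟘       ρ = refl
value-split 𝟙       ρ = refl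
value-split (s ⊕ t) ρ = trans (cong₂ _+_ (value-split s ρ) (value-split t ρ))
  (interchange (constant s) (linearPart s ρ) (constant t) (linearPart t ρ))
  where
  interchange : ∀ a b c d → (a + b) + (c + d) ≡ (a + c) + (b + d)
  interchange = solve-∀

linearPart-zeros : (t : Term n) → linearPart t (Vec.replicate n 0) ≡ 0
linearPart-zeros (var i) = Vec.lookup-replicate i 0
linearPart-zeros 𝟘       = refl
linearPart-zeros 𝟙       = refl
linearPart-zeros (s ⊕ t) = cong₂ _+_ (linearPart-zeros s) (linearPart-zeros t)

linearPart-digits : (t : Term n) (b : Vec Bool n) (ρ : Vec ℕ n) →
  linearPart t (Vec.zipWith digit b ρ) ≡ linearPart t ρ * 2 + linear t b
linearPart-digits (var i) b ρ = Vec.lookup-zipWith digit i b ρ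
linearPart-digits 𝟘       b ρ = refl
linearPart-digits 𝟙       b ρ = refl
linearPart-digits (s ⊕ t) b ρ = trans (cong₂ _+_ (linearPart-digits s b ρ) (linearPart-digits t b ρ))
  (regroup (linearPart s ρ) (linear s b) (linearPart t ρ) (linear t b))
  where
  regroup : ∀ a b c d → (a * 2 + b) + (c * 2 + d) ≡ (a + c) * 2 + (b + d)
  regroup = solve-∀

-- The automaton of an equation

module _ {n} (s t : Term n) where

  private
    E = equality s t
    left : Fin (suc (weight s) * suc (weight t)) → Carry s
    left = quotient (suc (weight t))
    right : Fin (suc (weight s) * suc (weight t)) → Carry t
    right = remainder {suc (weight s)} (suc (weight t))

    pending : (u : Term n) → Carry u → Word n → ℕ
    pending u c w = toℕ c + linearPart u (decode w)

    toℕ-carry : ∀ (u : Term n) (c : Carry u) b → toℕ (carry u c b) ≡ ⌊ total u c b /2⌋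
    toℕ-carry u c b = Fin.toℕ-fromℕ< _

    pending-∷ : ∀ (u : Term n) (c : Carry u) b w →
      pending u c (b ∷ w) ≡ pending u (carry u c b) w * 2 + total u c b % 2
    pending-∷ u c b w = begin
      toℕ c + linearPart u (decode (b ∷ w))
        ≡⟨ cong (toℕ c +_) (linearPart-digits u b (decode w)) ⟩
      toℕ c + (L * 2 + linear u b)
        ≡⟨ regroup (toℕ c) L (linear u b) ⟩
      L * 2 + z
        ≡⟨ cong (L * 2 +_) (halves z) ⟩
      L * 2 + (⌊ z /2⌋ * 2 + z % 2)
        ≡⟨ regroup′ L ⌊ z /2⌋ (z % 2) ⟩
      (⌊ z /2⌋ + L) * 2 + z % 2
        ≡⟨ cong (λ h → (h + L) * 2 + z % 2) (toℕ-carry u c b) ⟨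
      pending u (carry u c b) w * 2 + z % 2 ∎
      where
      open ≡-Reasoning
      L = linearPart u (decode w)
      z = total u c b
      regroup : ∀ a b c → a + (b * 2 + c) ≡ b * 2 + (a + c)
      regroup = solve-∀
      regroup′ : ∀ a b c → a * 2 + (b * 2 + c) ≡ (b + a) * 2 + c
      regroup′ = solve-∀

    pending-[] : ∀ (u : Term n) (c : Carry u) → pending u c [] ≡ toℕ c
    pending-[] u c = trans (cong (toℕ c +_) (linearPart-zeros u)) (+-identityʳ _)

  equality-dead : ∀ w → ¬ AcceptsFrom E zero w
  equality-dead []      ()
  equality-dead (b ∷ w) = equality-dead w

  equality-step : ∀ q b w → let X = total s (left q) b ; Y = total t (right q) b in
    AcceptsFrom E (step E (suc q) b) w ⇔
    (X % 2 ≡ Y % 2 × AcceptsFrom E (suc (combine (carry s (left q) b) (carry t (right q) b))) w)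
  equality-step q b w with total s (left q) b % 2 ≡ᵇ total t (right q) b % 2 in eq
  ... | true  = mk⇔ (λ acc → ≡ᵇ⇒≡ _ _ (subst T (sym eq) _) , acc) proj₂
  ... | false = mk⇔ (λ acc → contradiction acc (equality-dead w))
                    (λ { (≡2 , _) → contradiction (≡⇒≡ᵇ _ _ ≡2) (subst (¬_ ∘ T) (sym eq) λ ()) })

  -- Two numbers agree iff their lowest bits and their halves do. By `pending-∷` the lowest bit of a
  -- pending value is the parity that the automaton compares, and the half is the pending value
  -- after the step. At the end of the word only the carries are left.
  equality-from : ∀ q w → AcceptsFrom E (suc q) w ⇔ (pending s (left q) w ≡ pending t (right q) w)
  equality-from q [] rewrite pending-[] s (left q) | pending-[] t (right q) =
    mk⇔ (λ eq → ≡ᵇ⇒≡ _ _ (subst T (sym eq) _))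
        (λ eq → to Bool.T-≡ (≡⇒≡ᵇ _ _ eq))
  equality-from q (b ∷ w) = mk⇔
    (λ acc → let ≡2 , acc′ = to (equality-step q b w) acc
             in trans (pending-∷ s (left q) b w)
                (trans (cong₂ (λ x y → x * 2 + y) (trans (sym s≡) (trans (to IH acc′) t≡)) ≡2)
                       (sym (pending-∷ t (right q) b w))))
    (λ eq → let ≡h , ≡2 = quotient-remainder-unique (m%n<n (total s (left q) b) 2) (m%n<n (total t (right q) b) 2)
                            (trans (sym (pending-∷ s (left q) b w)) (trans eq (pending-∷ t (right q) b w)))
            in from (equality-step q b w) (≡2 , from IH (trans s≡ (trans ≡h (sym t≡)))))
    where
    c = carry s (left q) b
    d = carry t (right q) b
    IH = equality-from (combine c d) w
    s≡ : pending s (left (combine c d)) w ≡ pending s c w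
    s≡ = cong (λ cd → pending s (proj₁ cd) w) (Fin.remQuot-combine c d)
    t≡ : pending t (right (combine c d)) w ≡ pending t d w
    t≡ = cong (λ cd → pending t (proj₂ cd) w) (Fin.remQuot-combine c d)

  equality-recognises : Recognises E (λ ρ → value s ρ ≡ value t ρ)
  equality-recognises w = mk⇔
    (λ acc → trans s≡ (trans (to (equality-from q₀ w) acc) (sym t≡)))
    (λ eq → from (equality-from q₀ w) (trans (sym s≡) (trans eq t≡)))
    where
    q₀ = combine (carry₀ s) (carry₀ t)
    initially : ∀ (u : Term n) (c : Carry u) → toℕ c ≡ constant u → value u (decode w) ≡ pending u c w
    initially u c c≡ = trans (value-split u (decode w)) (cong (_+ linearPart u (decode w)) (sym c≡))
    s≡ : value s (decode w) ≡ pending s (left q₀) w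
    s≡ = initially s (left q₀) (trans (cong (toℕ ∘ proj₁) (Fin.remQuot-combine (carry₀ s) (carry₀ t))) (Fin.toℕ-fromℕ< _))
    t≡ : value t (decode w) ≡ pending t (right q₀) w
    t≡ = initially t (right q₀) (trans (cong (toℕ ∘ proj₂) (Fin.remQuot-combine (carry₀ s) (carry₀ t))) (Fin.toℕ-fromℕ< _))

not-true⇔ : ∀ {b} → not b ≡ true ⇔ (¬ b ≡ true)
not-true⇔ {false} = mk⇔ (λ _ ()) (λ _ → refl)
not-true⇔ {true}  = mk⇔ (λ ()) (contradiction refl)

∧-true⇔ : ∀ {a b} → a ∧ b ≡ true ⇔ (a ≡ true × b ≡ true)
∧-true⇔ {false} = mk⇔ (λ ()) proj₁
∧-true⇔ {true}  = mk⇔ (refl ,_) proj₂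

∨-true⇔ : ∀ {a b} → a ∨ b ≡ true ⇔ (a ≡ true ⊎ b ≡ true)
∨-true⇔ {false} = mk⇔ inj₂ λ { (inj₁ ()) ; (inj₂ eq) → eq }
∨-true⇔ {true}  = mk⇔ inj₁ (λ _ → refl)

→-true⇔ : ∀ {a b} → not a ∨ b ≡ true ⇔ (a ≡ true → b ≡ true)
→-true⇔ {false} = mk⇔ (λ _ ()) (λ _ → refl)
→-true⇔ {true}  = mk⇔ (λ eq _ → eq) (λ f → f refl)

run-complement : (A : DFA n) (q : Fin (size A)) (w : Word n) → run (complement A) q w ≡ run A q w
run-complement A q []      = refl
run-complement A q (b ∷ w) = run-complement A (step A q b) w

complement-accepts : (A : DFA n) (w : Word n) → Accepts (complement A) w ⇔ (¬ Accepts A w)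
complement-accepts A w rewrite run-complement A (start A) w = not-true⇔

complement-recognises : {A : DFA n} {P : Vec ℕ n → Set} →
  Recognises A P → Recognises (complement A) (λ ρ → ¬ P ρ)
complement-recognises {A = A} R w = mk⇔
  (λ acc p → to (complement-accepts A w) acc (from (R w) p))
  (λ ¬p → from (complement-accepts A w) (¬p ∘ to (R w)))

product-run : (op : Bool → Bool → Bool) (A B : DFA n) (q : Fin (size A * size B)) (w : Word n) →
  Fin.remQuot {size A} (size B) (run (product op A B) q w) ≡
  (run A (quotient {size A} (size B) q) w , run B (remainder {size A} (size B) q) w)
product-run op A B q []      = refl
product-run op A B q (b ∷ w) = trans (product-run op A B _ w)
  (cong (λ (r , r′) → run A r w , run B r′ w) (Fin.remQuot-combine _ _))

product-final : (op : Bool → Bool → Bool) (A B : DFA n) (w : Word n) →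
  final (product op A B) (run (product op A B) (start (product op A B)) w) ≡
  op (final A (run A (start A) w)) (final B (run B (start B) w))
product-final op A B w = cong (λ (r , r′) → op (final A r) (final B r′))
  (trans (product-run op A B (start (product op A B)) w)
         (cong (λ (r , r′) → run A r w , run B r′ w) (Fin.remQuot-combine (start A) (start B))))

-- Projection and the subset construction

comprehension-∋ : ∀ {N} {P : Pred (Fin N) 0ℓ} (P? : ∀ q → Dec (P q)) {q} → comprehension P? ∋ q ⇔ P q
comprehension-∋ P? {q} = mk⇔ (λ ∋q → indicated (P? q) (trans (sym eq) ∋q)) (λ p → trans eq (indicate (P? q) p))
  where
  eq = Fin.finToFun-funToFin {n = 2} (λ q → if does (P? q) then suc zero else zero) q
  indicated : (p? : Dec P) → (if does p? then suc zero else zero) ≡ Fin.fromℕ 1 → P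
  indicated (yes p) _ = p
  indicate : (p? : Dec P) → P → (if does p? then suc zero else zero) ≡ Fin.fromℕ 1
  indicate (yes _) p = refl
  indicate (no ¬p) p = contradiction p ¬p

-- Each letter leaves both values of the erased bit open, so the set reached collects the ends of
-- all runs over guesses of the erased track.
project-run : (A : DFA (suc n)) (S : Subset (size A)) (w : Word n) {q′ : Fin (size A)} →
  run (project A) S w ∋ q′ ⇔
  (∃₂ λ q v → S ∋ q × List.map Vec.tail v ≡ w × run A q v ≡ q′)
project-run A S [] = mk⇔
  (λ S∋q′ → _ , [] , S∋q′ , refl , refl)
  λ { (q , [] , S∋q , refl , refl) → S∋q }
project-run A S (b ∷ w) = mk⇔
  (λ reach → let q₁ , v , S₁∋q₁ , tails , end = to (project-run A (step (project A) S b) w) reach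
             in unstep v tails end (to (comprehension-∋ (move? A S b)) S₁∋q₁))
  (λ { (q , (a ∷ b′) ∷ v , S∋q , tails , end) → case ∷-injective tails of λ { (refl , tails′) →
       from (project-run A (step (project A) S b) w)
         (_ , v , from (comprehension-∋ (move? A S b)) (q , S∋q , choose a) , tails′ , end) } })
  where
  choose : ∀ a {q} → step A q (false ∷ b) ≡ step A q (a ∷ b) ⊎ step A q (true ∷ b) ≡ step A q (a ∷ b)
  choose false = inj₁ refl
  choose true  = inj₂ refl
  unstep : ∀ {q₁ q′} v → List.map Vec.tail v ≡ w → run A q₁ v ≡ q′ →
    (∃ λ q → (S ∋ q) × (step A q (false ∷ b) ≡ q₁ ⊎ step A q (true ∷ b) ≡ q₁)) →
    ∃₂ λ q v → S ∋ q × List.map Vec.tail v ≡ b ∷ w × run A q v ≡ q′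
  unstep v tails end (q , S∋q , inj₁ refl) = q , (false ∷ b) ∷ v , S∋q , cong (b ∷_) tails , end
  unstep v tails end (q , S∋q , inj₂ refl) = q , (true ∷ b) ∷ v , S∋q , cong (b ∷_) tails , end

padding : ∀ n → ℕ → Word n
padding n k = List.replicate k (zeros n)

run-++ : (A : DFA n) (q : Fin (size A)) (v w : Word n) → run A q (v ++ w) ≡ run A (run A q v) w
run-++ A q []      w = refl
run-++ A q (b ∷ v) w = run-++ A (step A q b) v w

run-padding : (A : DFA (suc n)) (S : Subset (size A)) (k : ℕ) →
              run (project A) S (padding n k) ≡ padded A S k
-- `run` changes the starting set whereas `fold` adds steps on the outside; `iterate` recurses like
-- `run`, and the two iterations agree.
run-padding {n} A S k = trans (as-iterate S k) (sym (iterate-is-fold S (λ S → step (project A) S (zeros n)) k))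
  where
  as-iterate : ∀ S k → run (project A) S (padding n k) ≡ iterate (λ S → step (project A) S (zeros n)) S k
  as-iterate S zero    = refl
  as-iterate S (suc k) = as-iterate (step (project A) S (zeros n)) k

decode-padding : ∀ (w : Word n) k → decode (w ++ padding n k) ≡ decode w
decode-padding {n} (b ∷ w) k = cong (Vec.zipWith digit b) (decode-padding w k)
decode-padding []      zero    = refl
decode-padding {n} []  (suc k) = trans (cong (Vec.zipWith digit (zeros n)) (decode-padding [] k))
  (Vec.zipWith-replicate digit false 0)

tail-decode : (v : Word (suc n)) → Vec.tail (decode v) ≡ decode (List.map Vec.tail v)
tail-decode []            = refl
tail-decode ((a ∷ b) ∷ v) with decode v | tail-decode v
... | x ∷ ρ | eq = cong (Vec.zipWith digit b) eq

decode-∷ : (v : Word (suc n)) → decode v ≡ Vec.head (decode v) ∷ decode (List.map Vec.tail v)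
decode-∷ v with decode v | tail-decode v
... | x ∷ ρ | eq = cong (x ∷_) eq

odd : ℕ → Bool
odd zero          = false
odd (suc zero)    = true
odd (suc (suc x)) = odd x

digit-odd : ∀ x → digit (odd x) ⌊ x /2⌋ ≡ x
digit-odd zero          = refl
digit-odd (suc zero)    = refl
digit-odd (suc (suc x)) = cong (2 +_) (digit-odd x)

-- The digits of `x` fill the new track along `w`; those left over are written above `k` additional
-- zero letters. This is why acceptance by the projection must allow for padding.
add-track : ∀ x (w : Word n) → ∃₂ λ k v → List.map Vec.tail v ≡ w ++ padding n k × decode v ≡ x ∷ decode w
add-track {n} x (b ∷ w) =
  let k , v , tails , dec = add-track ⌊ x /2⌋ w
  in k , (odd x ∷ b) ∷ v , cong (b ∷_) tails ,
     trans (cong (Vec.zipWith digit (odd x ∷ b)) dec) (cong (_∷ decode (b ∷ w)) (digit-odd x))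
add-track {n} x [] = digits x x ≤-refl
  where
  -- Halving is not structural recursion; the decreasing `bound` makes it so.
  digits : ∀ bound x → x ≤ bound →
           ∃₂ λ k v → List.map Vec.tail v ≡ padding n k × decode v ≡ x ∷ decode []
  digits bound       zero    _       = 0 , [] , refl , refl
  digits (suc bound) (suc x) (s≤s x≤bound) =
    let k , v , tails , dec = digits bound ⌊ suc x /2⌋ (≤-trans (s≤s⁻¹ (⌊n/2⌋<n x)) x≤bound)
    in suc k , (odd (suc x) ∷ zeros n) ∷ v , cong (zeros n ∷_) tails ,
       trans (cong (Vec.zipWith digit (odd (suc x) ∷ zeros n)) dec)
             (cong₂ _∷_ (digit-odd (suc x)) (decode-padding [] 1))

project-accepts : (A : DFA (suc n)) (w : Word n) →
  Accepts (project A) w ⇔ (∃₂ λ k v → List.map Vec.tail v ≡ w ++ padding n k × Accepts A v)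
project-accepts {n} A w = mk⇔
  (λ acc → let k , q , S∋q , fin = to final⇔ acc
           in toℕ k , reach⇒word (toℕ k) S∋q fin)
  (λ { (k , v , tails , acc) →
       -- Here `k` is arbitrary, as `add-track` may ask for any padding, whereas the final states
       -- are tested only for `k′` below `2 ^ size A`.
       let k′ , k′<2ᴺ , same = Orbit.revisits (λ S → step (project A) S (zeros n)) S Fin._≟_
                                  (mk↣ {to = λ S → S} (λ eq → eq)) k
           S∋q = from (project-run A S₀ (w ++ padding n k)) (start A , v , from start∋ refl , tails , refl)
           S∋q′ = subst (λ S → S ∋ run A (start A) v) (trans (split k) (trans same (cong (padded A S) (sym (Fin.toℕ-fromℕ< k′<2ᴺ))))) S∋q
       in from final⇔ (Fin.fromℕ< k′<2ᴺ , _ , S∋q′ , acc) })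
  where
  S₀ = start (project A)
  S  = run (project A) S₀ w
  split : ∀ k → run (project A) S₀ (w ++ padding n k) ≡ padded A S k
  split k = trans (run-++ (project A) S₀ w (padding n k)) (run-padding A S k)
  start∋ : ∀ {q} → S₀ ∋ q ⇔ q ≡ start A
  start∋ = comprehension-∋ (λ q → q Fin.≟ start A)
  final⇔ : final (project A) S ≡ true ⇔
           (∃ λ (k : Fin (2 ^ size A)) → ∃ λ q → (padded A S (toℕ k) ∋ q) × final A q ≡ true)
  final⇔ with final? A S
  ... | yes p = mk⇔ (λ _ → p) (λ _ → refl)
  ... | no ¬p = mk⇔ (λ ()) (λ p → contradiction p ¬p)
  reach⇒word : ∀ k {q} → padded A S k ∋ q → final A q ≡ true →
               ∃ λ v → List.map Vec.tail v ≡ w ++ padding n k × Accepts A v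
  reach⇒word k {q} S∋q fin with to (project-run A S₀ (w ++ padding n k) {q}) (subst (λ S → S ∋ q) (sym (split k)) S∋q)
  ... | q₀ , v , S₀∋q₀ , tails , refl with to start∋ S₀∋q₀
  ...   | refl = v , tails , fin

project-recognises : {A : DFA (suc n)} {P : Vec ℕ (suc n) → Set} →
  Recognises A P → Recognises (project A) (λ ρ → ∃ λ x → P (x ∷ ρ))
project-recognises {n} {A} {P} R w = mk⇔
  (λ acc → let k , v , tails , acc′ = to (project-accepts A w) acc
           in Vec.head (decode v) , subst P
                (trans (decode-∷ v) (cong (Vec.head (decode v) ∷_) (trans (cong decode tails) (decode-padding w k))))
                (to (R v) acc′))
  (λ { (x , p) → let k , v , tails , dec = add-track x w
                 in from (project-accepts A w) (k , v , tails , from (R v) (subst P (sym dec) p)) })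

automaton-recognises : (φ : Formula n) → Recognises (automaton φ) (_⊨ φ)
automaton-recognises (s ≐ t) w = equality-recognises s t w
automaton-recognises (neg φ) =
  complement-recognises {A = automaton φ} {P = _⊨ φ} (automaton-recognises φ)
automaton-recognises (conj φ ψ) w rewrite product-final _∧_ (automaton φ) (automaton ψ) w =
  (automaton-recognises φ w ×-⇔ automaton-recognises ψ w) ⇔-∘ ∧-true⇔
automaton-recognises (disj φ ψ) w rewrite product-final _∨_ (automaton φ) (automaton ψ) w =
  (automaton-recognises φ w ⊎-⇔ automaton-recognises ψ w) ⇔-∘ ∨-true⇔
automaton-recognises (imp φ ψ) w rewrite product-final (λ a b → not a ∨ b) (automaton φ) (automaton ψ) w =
  mk⇔ (λ f → to (automaton-recognises ψ w) ∘ f ∘ from (automaton-recognises φ w))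
      (λ f → from (automaton-recognises ψ w) ∘ f ∘ to (automaton-recognises φ w)) ⇔-∘ →-true⇔
automaton-recognises (all φ) w = mk⇔
  -- Passing from `¬ ∃ ¬` to `∀` needs a decidable matrix. The automaton of `φ` decides it, on a
  -- word that carries `x` as an additional track.
  (λ acc x → decidable-stable (satisfies? x) λ ¬m →
     to (complement-accepts B w) acc (from (B-recognises w) (x , ¬m)))
  (λ m → from (complement-accepts B w) λ acc → let x , ¬m = to (B-recognises w) acc in ¬m (m x))
  where
  B = project (complement (automaton φ))
  B-recognises : Recognises B (λ ρ → ∃ λ x → ¬ ((x ∷ ρ) ⊨ φ))
  B-recognises = project-recognises {A = complement (automaton φ)} {P = λ ρ → ¬ (ρ ⊨ φ)} 
    (complement-recognises {A = automaton φ} {P = _⊨ φ} (automaton-recognises φ))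
  satisfies? : ∀ x → Dec ((x ∷ decode w) ⊨ φ)
  satisfies? x = let k , v , tails , dec = add-track x w in
    subst (λ ρ → Dec (ρ ⊨ φ)) dec (Dec.map (automaton-recognises φ v) (accepts? (automaton φ) v))
automaton-recognises (ex φ) = project-recognises {A = automaton φ} {P = _⊨ φ} (automaton-recognises φ)

-- The canonical adjudicator

-- A decision program answers 1 for manifestation, but the adjudicator annuls with 1. The exchange
-- is made stage by stage, so `c` may search for long, or forever outside the domain, and the first
-- stage with an output stays the same.
flip : Program → Program
flip c = lam (lam (lam (lam (if posᵀ ∙ v0 then su (notᵀ ∙ (predᵀ ∙ v0)) else ze end)
                        ∙ (v2 ∙ v1 ∙ v0)))) ∙ c

flip⇓ : ∀ c {p v w} → v ≡ bit (not w) → c ⟨ p ⟩⇓ bit w → flip c ⟨ p ⟩⇓ v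
flip⇓ c {p} {v} {w} v≡ (k , ck , below) =
  k , stage k (_≡ suc v)
        (λ _ → cong suc (trans (not≡ {b = w} (pred≡ ck)) (sym v≡)))
        (λ ≮ → contradiction (subst (0 <_) (sym ck) (s≤s z≤n)) ≮) ,
  λ j j<k → stage j (_≡ 0)
        (λ 0< → contradiction (subst (0 <_) (below j j<k) 0<) λ ())
        (λ _ → refl)
  where
  stage : ∀ k (R : ℕ → Set) → let y = ⟦ c ⟧ [] p k in
    (0 < y → R (suc (⟦ notᵀ ⟧ (y ∷ k ∷ p ∷ ⟦ c ⟧ [] ∷ []) (⟦ predᵀ ⟧ (y ∷ k ∷ p ∷ ⟦ c ⟧ [] ∷ []) y)))) →
    (¬ 0 < y → R 0) → R (⟦ flip c ⟧ [] p k)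
  stage k R = if-elim R (decides-pos refl)

χ-total : ∀ D → DecidableDomain D → Total D (χ D)
χ-total D (c , answers) p p∈D with answers p p∈D
... | inj₁ (m , _)  = 0 , kept p∈D m
... | inj₂ (¬m , _) = 1 , annulled p∈D ¬m

χ-computable : ∀ D → DecidableDomain D → Computable D (χ D)
χ-computable D (c , answers) = flip c , λ p p∈D v → mk⇔ (graph⇒⇓ p p∈D) (⇓⇒graph p p∈D)
  where
  graph⇒⇓ : ∀ p → Dist D p → ∀ {v} → χ-Graph D p v → flip c ⟨ p ⟩⇓ v
  graph⇒⇓ p p∈D graph with answers p p∈D | graph
  ... | inj₁ (m , c⇓) | annulled _ ¬m = contradiction m ¬m
  ... | inj₁ (m , c⇓) | kept _ _      = flip⇓ c {w = true} refl c⇓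
  ... | inj₂ (_ , c⇓) | annulled _ _  = flip⇓ c {w = false} refl c⇓
  ... | inj₂ (¬m , _) | kept _ m      = contradiction m ¬m
  ⇓⇒graph : ∀ p → Dist D p → ∀ {v} → flip c ⟨ p ⟩⇓ v → χ-Graph D p v
  ⇓⇒graph p p∈D ⇓v =
    let w , graph = χ-total D (c , answers) p p∈D
    in subst (χ-Graph D p) (⇓-functional (flip c) (graph⇒⇓ p p∈D graph) ⇓v) graph

χ-correct : ∀ D → DecidableDomain D → Correct D (χ D)
χ-correct D _ p p∈D = mk⇔ (λ { (annulled _ ¬m) → ¬m }) (annulled p∈D)

-- Problems about coded objects

module Coded {I : Set} (code : I → ℕ) (R : I → Set) where

  -- The bit `x` is computed from `p` alone, so all objects with code `p` get the same verdict, and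
  -- `R` holds for all of them or for none. This does the work of injectivity of `code`.
  decides-coded : ∀ {p i} → (∀ {i} → p ≡ code i → Decides x (R i)) → p ≡ code i →
                  Decides x (∃ λ i → p ≡ code i × R i)
  decides-coded {i = i} decides p≡ with decides p≡
  ... | inj₁ (r , x≡1)  = inj₁ ((i , p≡ , r) , x≡1)
  ... | inj₂ (_ , x≡0)  = inj₂ ((λ (_ , p≡′ , r′) →
          contradiction (trans (sym x≡0) (decides-true (decides p≡′) r′)) λ ()) , x≡0)

  coded⇔ : ∀ {i} → (∀ {i′} → code i ≡ code i′ → Decides x (R i′)) →
           (∃ λ i′ → code i ≡ code i′ × R i′) ⇔ R i
  coded⇔ {i = i} decides = mk⇔
    (λ (_ , eq , r) → true-decides (decides refl) (decides-true (decides eq) r))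
    (λ r → i , refl , r)

certifies-by : ∀ {D P C} (f : Closed (nat ⇒ nat)) →
  (∀ {p} → Dist D p → ∀ w {Γ} {γ : Env Γ} → Decides (⟦ f ⟧ γ ⟨ p , w ⟩) (C p w)) →
  (∀ p → Dist D p → P p ⇔ (∃ λ w → C p w)) → Certifies D P C
certifies-by f decides P⇔C = record
  { computable = compute f , λ p p∈D w → decide-answers f (decides p∈D w)
  ; certifies  = P⇔C
  ; witness    = search f , λ p p∈D Pp → search⇓ f (λ w → decides p∈D w) (to (P⇔C p p∈D) Pp)
  }

-- Presburger arithmetic

run-end : {A : DFA n} {q r : Fin (size A)} {w : Word n} {qs : List (Fin (size A))} →
          Run A q w qs r → run A q w ≡ r
run-end stop     = refl
run-end (read p) = run-end p

run⇒complement : {A : DFA n} {q r : Fin (size A)} {w : Word n} {qs : List (Fin (size A))} →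
                 Run A q w qs r → Run (complement A) q w qs r
run⇒complement stop     = stop
run⇒complement (read p) = read (run⇒complement p)

complement⇒run : {A : DFA n} {q r : Fin (size A)} {w : Word n} {qs : List (Fin (size A))} →
                 Run (complement A) q w qs r → Run A q w qs r
complement⇒run stop     = stop
complement⇒run (read p) = read (complement⇒run p)

AcceptingFrom : (A : DFA n) → Fin (size A) → List (Fin (size A)) → Set
AcceptingFrom A q qs = ∃₂ λ w r → Run A q w qs r × final A r ≡ true

CodesAcceptingFrom : (A : DFA n) → ℕ → Fin (size A) → Set
CodesAcceptingFrom A w q = ∃ λ qs → w ≡ codeRun qs × AcceptingFrom A q qs

-- Over the one-letter alphabet the successor state is forced, so a list of states can be checked
-- entry by entry without guessing the word. A tail coded by 0 is empty, and there the run must stop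
-- in a final state.
accepting-unfold : (A : DFA 0) (w : ℕ) (q : Fin (size A)) → CodesAcceptingFrom A w q ⇔
  (0 < w × π₁ (pred w) ≡ toℕ q ×
    (CodesAcceptingFrom A (π₂ (pred w)) (step A q []) ⊎ (¬ 0 < π₂ (pred w) × final A q ≡ true)))
accepting-unfold A w q = mk⇔
  (λ { ([] , _ , _ , _ , () , _)
     ; (q ∷ [] , refl , _ , _ , stop , fin) →
         s≤s z≤n , π₁-pair (toℕ q) 0 , inj₂ (subst (λ r → ¬ 0 < r) (sym (π₂-pair (toℕ q) 0)) (λ ()) , fin)
     ; (q ∷ qs , refl , [] ∷ v , r , read run , fin) →
         s≤s z≤n , π₁-pair (toℕ q) (codeRun qs) , inj₁ (qs , π₂-pair (toℕ q) (codeRun qs) , v , r , run , fin) })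
  (λ { (0<w , head , inj₁ (qs , tail , v , r , run , fin)) →
         q ∷ qs , whole 0<w head tail , [] ∷ v , r , read run , fin
     ; (0<w , head , inj₂ (≮ , fin)) →
         q ∷ [] , whole 0<w head (n≤0⇒n≡0 (≮⇒≥ ≮)) , [] , q , stop , fin })
  where
  whole : ∀ {w a r} → 0 < w → π₁ (pred w) ≡ a → π₂ (pred w) ≡ r → w ≡ suc ⟨ a , r ⟩
  whole {suc w} _ refl refl = cong suc (sym (pair-unpair w))

tail-smaller : 0 < m → m < suc k → π₂ (pred m) < k
tail-smaller {suc m} _ (s≤s m<k) =
  ≤-<-trans (subst (π₂ m ≤_) (pair-unpair m) (right≤pair (π₁ m) (π₂ m))) m<k

opaque
  -- The tail of a nonempty list has a smaller code, so `su v0` rounds are enough to read the whole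
  -- list `v0`.
  acceptingᵀ : Closed (Aut ⇒ nat ⇒ nat)
  acceptingᵀ = lam (lam
    (rec (lam (lam ze)) (lam (lam (lam (lam
      (andᵀ ∙ (posᵀ ∙ v1) ∙ (andᵀ ∙ (eqᵀ ∙ (headᵀ ∙ v1) ∙ v0) ∙
        (orᵀ ∙ (v2 ∙ (tailᵀ ∙ v1) ∙ (stepᵀ v5 ∙ v0 ∙ lam ze))
             ∙ (andᵀ ∙ (notᵀ ∙ (posᵀ ∙ (tailᵀ ∙ v1))) ∙ (finalᵀ v5 ∙ v0))))))))) (su v0)
     ∙ v0 ∙ startᵀ v1))

  decides-accepting : ∀ {v w} {A : DFA 0} → Represents v A →
    Decides (⟦ acceptingᵀ ⟧ γ v w) (CodesAcceptingFrom A w (start A))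
  decides-accepting {w = w} {A} V = primRec-induction {A = ℕ → ℕ → ℕ}
    (λ k f → ∀ {w x} → w < k → x ≡ w → ∀ q {y} → y ≡ toℕ q → Decides (f x y) (CodesAcceptingFrom A w q))
    (λ ())
    (λ IH {w} w≤k x≡ q y≡ → decides-map (⇔-sym (accepting-unfold A w q))
      (decides-×-given (decides-pos x≡) λ 0<w → decides-× (decides-≡ (head≡ x≡) y≡)
        (decides-⊎ (IH (tail-smaller 0<w w≤k) (tail≡ x≡) (step A q []) (step≡ V y≡ λ ()))
                   (decides-× (decides-¬ (decides-pos (tail≡ x≡))) (bit⇒decides (final≡ V y≡))))))
    (suc w) ≤-refl refl (start A) (start≡ V)

truth⇔accepts : (φ : Sentence) (w : Word 0) → ℕ⊨ φ ⇔ Accepts (automaton φ) w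
truth⇔accepts φ w with decode w | automaton-recognises φ w
... | [] | recognises = ⇔-sym recognises

opaque
  -- With no tracks every word encodes the empty tuple, so the empty word decides: the sentence
  -- holds iff the start state is final.
  truthᵀ : Closed (nat ⇒ nat)
  truthᵀ = lam (lam (finalᵀ v0 ∙ startᵀ v0) ∙ (automatonᵀ ∙ v0))

  decides-truth : {φ : Sentence} → x ≡ codeFormula φ → Decides (⟦ truthᵀ ⟧ γ x) (ℕ⊨ φ)
  decides-truth {φ = φ} x≡ =
    let V = automaton-represents {φ = φ} x≡
    in decides-map (⇔-sym (truth⇔accepts φ [])) (bit⇒decides (final≡ V (start≡ V)))

presburger-decidable : DecidableDomain Presburger
presburger-decidable = compute truthᵀ , λ { p (φ , p≡) →
  decide-answers truthᵀ (Coded.decides-coded codeFormula ℕ⊨_ {i = φ} decides-truth p≡) }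

truth⇔𝐌 : (φ : Sentence) → 𝐌 Presburger (codeFormula φ) ⇔ (ℕ⊨ φ)
truth⇔𝐌 φ = Coded.coded⇔ codeFormula ℕ⊨_ {x = ⟦ truthᵀ ⟧ [] (codeFormula φ)} decides-truth

CodesAccepting : DFA 0 → ℕ → Set
CodesAccepting A w = CodesAcceptingFrom A w (start A)

-- Complementation only exchanges the final states, so the checker for accepting runs also handles
-- rejecting ones.
codes-complement⇔ : (A : DFA 0) (w : ℕ) → CodesAccepting (complement A) w ⇔
  (∃ λ qs → w ≡ codeRun qs × RejectingRun A qs)
codes-complement⇔ A w = mk⇔
  (λ (qs , w≡ , v , r , run , fin) → qs , w≡ , v , r , complement⇒run run , Bool.not-injective fin)
  (λ (qs , w≡ , v , r , run , fin) → qs , w≡ , v , r , run⇒complement run , cong not fin)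

accepting-certificate⇔ : ∀ p w → AcceptingCertificate p w ⇔
  (∃ λ (φ : Sentence) → p ≡ codeFormula φ × CodesAccepting (automaton φ) w)
accepting-certificate⇔ p w = mk⇔ (λ (φ , qs , p≡ , w≡ , run) → φ , p≡ , qs , w≡ , run)
                                 (λ (φ , p≡ , qs , w≡ , run) → φ , qs , p≡ , w≡ , run)

rejecting-certificate⇔ : ∀ p w → RejectingCertificate p w ⇔
  (∃ λ (φ : Sentence) → p ≡ codeFormula φ × CodesAccepting (complement (automaton φ)) w)
rejecting-certificate⇔ p w = mk⇔
  (λ (φ , qs , p≡ , w≡ , run) → φ , p≡ , from (codes-complement⇔ (automaton φ) w) (qs , w≡ , run))
  (λ (φ , p≡ , acc) → let qs , w≡ , run = to (codes-complement⇔ (automaton φ) w) acc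
                      in φ , qs , p≡ , w≡ , run)

opaque
  acceptingCertificateᵀ rejectingCertificateᵀ : Closed (nat ⇒ nat)
  acceptingCertificateᵀ = lam (acceptingᵀ ∙ (automatonᵀ ∙ (π₁ᵀ ∙ v0)) ∙ (π₂ᵀ ∙ v0))
  rejectingCertificateᵀ = lam (acceptingᵀ ∙ (complementᵀ ∙ (automatonᵀ ∙ (π₁ᵀ ∙ v0))) ∙ (π₂ᵀ ∙ v0))

  decides-acceptingCertificate : ∀ {p w} → Dist Presburger p → x ≡ ⟨ p , w ⟩ →
    Decides (⟦ acceptingCertificateᵀ ⟧ γ x) (AcceptingCertificate p w)
  decides-acceptingCertificate {p = p} {w} (φ , p≡) x≡ =
    decides-map (⇔-sym (accepting-certificate⇔ p w))
      (Coded.decides-coded codeFormula (λ φ → CodesAccepting (automaton φ) w) {i = φ}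
        (λ {ψ} p≡ → subst (λ w′ → Decides _ (CodesAccepting (automaton ψ) w′)) (pair-π₂≡ {m = p} x≡)
          (decides-accepting (automaton-represents {φ = ψ} (trans (pair-π₁≡ {n = w} x≡) p≡)))) p≡)

  decides-rejectingCertificate : ∀ {p w} → Dist Presburger p → x ≡ ⟨ p , w ⟩ →
    Decides (⟦ rejectingCertificateᵀ ⟧ γ x) (RejectingCertificate p w)
  decides-rejectingCertificate {p = p} {w} (φ , p≡) x≡ =
    decides-map (⇔-sym (rejecting-certificate⇔ p w))
      (Coded.decides-coded codeFormula (λ φ → CodesAccepting (complement (automaton φ)) w) {i = φ}
        (λ {ψ} p≡ → subst (λ w′ → Decides _ (CodesAccepting (complement (automaton ψ)) w′)) (pair-π₂≡ {m = p} x≡)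
          (decides-accepting (complement-represents
            (automaton-represents {φ = ψ} (trans (pair-π₁≡ {n = w} x≡) p≡))))) p≡)

-- Every word over the one-letter alphabet will do; these runs read the empty one.
accepting-certifies : ∀ p → Dist Presburger p → 𝐌 Presburger p ⇔ (∃ λ w → AcceptingCertificate p w)
accepting-certifies p _ = mk⇔
  (λ (φ , p≡ , holds) → codeRun (start (automaton φ) ∷ []) , φ , _ , p≡ , refl ,
     [] , _ , stop , to (truth⇔accepts φ []) holds)
  (λ (_ , φ , qs , p≡ , _ , w , r , run , fin) → φ , p≡ ,
     from (truth⇔accepts φ w) (trans (cong (final (automaton φ)) (run-end run)) fin))

rejecting-certifies : ∀ p → Dist Presburger p → (¬ 𝐌 Presburger p) ⇔ (∃ λ w → RejectingCertificate p w)
rejecting-certifies p (φ , p≡) = mk⇔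
  (λ ¬m → codeRun (start (automaton φ) ∷ []) , φ , _ , p≡ , refl , [] , _ , stop ,
     Bool.¬-not λ fin → ¬m (φ , p≡ , from (truth⇔accepts φ []) fin))
  -- The certificate names some sentence `ψ` with code `p`, not necessarily `φ`; `truth⇔𝐌` carries
  -- manifestation of the number over to `ψ`.
  (λ { (_ , ψ , qs , refl , _ , w , r , run , fin) m →
     case trans (sym (to (truth⇔accepts ψ w) (to (truth⇔𝐌 ψ) m)))
                (trans (cong (final (automaton ψ)) (run-end run)) fin) of λ () })

presburger-acceptingCertificates : Certifies Presburger (𝐌 Presburger) AcceptingCertificate
presburger-acceptingCertificates = certifies-by acceptingCertificateᵀ
  (λ p∈D w → decides-acceptingCertificate p∈D refl) accepting-certifies

presburger-rejectingCertificates : CertificateScheme Presburger RejectingCertificate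
presburger-rejectingCertificates = certifies-by rejectingCertificateᵀ
  (λ p∈D w → decides-rejectingCertificate p∈D refl) rejecting-certifies

-- Tag and certificate are sought together as a single number, so one search settles the verdict and
-- finds its certificate.
Verdict : (C⁺ C⁻ : ℕ → ℕ → Set) → ℕ → ℕ → Set
Verdict C⁺ C⁻ p k = (π₁ k ≡ 0 × C⁺ p (π₂ k)) ⊎ (π₁ k ≡ 1 × C⁻ p (π₂ k))

opaque
  verdictᵀ : Closed (nat ⇒ nat) → Closed (nat ⇒ nat) → Closed (nat ⇒ nat)
  verdictᵀ f⁺ f⁻ = lam (lam (lam (lam (orᵀ
    ∙ (andᵀ ∙ (eqᵀ ∙ v1 ∙ ze) ∙ (f⁺ ∙ (pairᵀ ∙ v2 ∙ v0)))
    ∙ (andᵀ ∙ (eqᵀ ∙ v1 ∙ one) ∙ (f⁻ ∙ (pairᵀ ∙ v2 ∙ v0))))))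
    ∙ (π₁ᵀ ∙ v0) ∙ (π₁ᵀ ∙ (π₂ᵀ ∙ v0)) ∙ (π₂ᵀ ∙ (π₂ᵀ ∙ v0)))

  decides-verdict : ∀ {C⁺ C⁻ p} (f⁺ f⁻ : Closed (nat ⇒ nat)) →
    (∀ {x w Γ} {γ : Env Γ} → x ≡ ⟨ p , w ⟩ → Decides (⟦ f⁺ ⟧ γ x) (C⁺ p w)) →
    (∀ {x w Γ} {γ : Env Γ} → x ≡ ⟨ p , w ⟩ → Decides (⟦ f⁻ ⟧ γ x) (C⁻ p w)) →
    ∀ k → Decides (⟦ verdictᵀ f⁺ f⁻ ⟧ γ ⟨ p , k ⟩) (Verdict C⁺ C⁻ p k)
  decides-verdict {p = p} f⁺ f⁻ decides⁺ decides⁻ k = decides-⊎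
    (decides-× (decides-≡ (π₁≡ {m = k} k≡) refl) (decides⁺ (pair≡ p≡ (π₂≡ {m = k} k≡))))
    (decides-× (decides-≡ (π₁≡ {m = k} k≡) refl) (decides⁻ (pair≡ p≡ (π₂≡ {m = k} k≡))))
    where
    p≡ : ∀ {Γ} {γ : Env Γ} → ⟦ π₁ᵀ ⟧ γ ⟨ p , k ⟩ ≡ p
    p≡ = pair-π₁≡ {n = k} refl
    k≡ : ∀ {Γ} {γ : Env Γ} → ⟦ π₂ᵀ ⟧ γ ⟨ p , k ⟩ ≡ k
    k≡ = pair-π₂≡ {m = p} refl

presburger-certifiedDecision : CertifiedDecision Presburger AcceptingCertificate RejectingCertificate
presburger-certifiedDecision = search program , λ p p∈D →
  let k , k⇓ , verdict = search⇓ {P = Verdict AcceptingCertificate RejectingCertificate p} program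
        (λ k → decides-verdict {C⁺ = AcceptingCertificate} {RejectingCertificate} {p}
          acceptingCertificateᵀ rejectingCertificateᵀ
          (decides-acceptingCertificate p∈D) (decides-rejectingCertificate p∈D) k)
        (some-verdict p p∈D)
  in π₂ k , Sum.map
       (λ (tag , C) → from (accepting-certifies p p∈D) (π₂ k , C) , C , output k k⇓ tag)
       (λ (tag , C) → from (rejecting-certifies p p∈D) (π₂ k , C) , C , output k k⇓ tag) verdict
  where
  program : Closed (nat ⇒ nat)
  program = verdictᵀ acceptingCertificateᵀ rejectingCertificateᵀ
  output : ∀ {p t} k → search program ⟨ p ⟩⇓ k → π₁ k ≡ t → search program ⟨ p ⟩⇓ ⟨ t , π₂ k ⟩
  output {p} k k⇓ refl = subst (search program ⟨ p ⟩⇓_) (sym (pair-unpair k)) k⇓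
  some-verdict : ∀ p → Dist Presburger p → ∃ (Verdict AcceptingCertificate RejectingCertificate p)
  some-verdict p p∈D@(φ , refl) with decides-truth {γ = []} {φ = φ} refl
  ... | inj₁ (t , _) = let w , C = to (accepting-certifies p p∈D) (φ , refl , t)
    in ⟨ 0 , w ⟩ , inj₁ (π₁-pair 0 w , subst (AcceptingCertificate p) (sym (π₂-pair 0 w)) C)
  ... | inj₂ (f , _) = let w , C = to (rejecting-certifies p p∈D) (f ∘ to (truth⇔𝐌 φ))
    in ⟨ 1 , w ⟩ , inj₂ (π₁-pair 1 w , subst (RejectingCertificate p) (sym (π₂-pair 1 w)) C)

-- Re-entry systems

vec-ext : ∀ {A : Set} {u v : Vec A n} → (∀ i → lookup u i ≡ lookup v i) → u ≡ v
vec-ext {u = u} {v} eq = begin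
  u                         ≡⟨ Vec.tabulate∘lookup u ⟨
  Vec.tabulate (lookup u)   ≡⟨ Vec.tabulate-cong eq ⟩
  Vec.tabulate (lookup v)   ≡⟨ Vec.tabulate∘lookup v ⟩
  v                         ∎
  where open ≡-Reasoning

bit-injective : ∀ {a b} → bit a ≡ bit b → a ≡ b
bit-injective {false} {false} _ = refl
bit-injective {true}  {true}  _ = refl

state↣Fin : State n ↣ Fin (2 ^ n)
state↣Fin {n} = mk↣ {to = λ s → funToFin (digits s)} λ {s} {t} eq → vec-ext λ i →
  bitFin-injective (trans (sym (Fin.finToFun-funToFin (digits s) i))
                   (trans (cong (λ k → finToFun k i) eq) (Fin.finToFun-funToFin (digits t) i)))
  where
  bitFin : Bool → Fin 2
  bitFin false = zero
  bitFin true  = suc zero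
  bitFin-injective : ∀ {a b} → bitFin a ≡ bitFin b → a ≡ b
  bitFin-injective {false} {false} _ = refl
  bitFin-injective {true}  {true}  _ = refl
  digits : State n → Fin n → Fin 2
  digits s i = bitFin (lookup s i)

module _ (S : System n) where

  open Orbit (next S) (initial S)

  private
    _≟ˢ_ = Vec.≡-dec {n = n} Bool._≟_

  system-transientPeriod : ∃₂ λ μ π → IsTransientPeriod (orbit S) μ π
  system-transientPeriod =
    let μ , π , L = lasso _≟ˢ_ state↣Fin in μ , π , lasso⇒transientPeriod L

  transientPeriod⇔lasso : ∀ μ π → IsTransientPeriod (orbit S) μ π ⇔ Lasso (orbit S) μ π
  transientPeriod⇔lasso μ π = mk⇔ (transientPeriod⇒lasso _≟ˢ_ state↣Fin) lasso⇒transientPeriod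

  transientPeriod-bounded : ∀ {μ π} → IsTransientPeriod (orbit S) μ π → μ + π ≤ 2 ^ n
  transientPeriod-bounded T =
    lasso-bounded _≟ˢ_ state↣Fin (transientPeriod⇒lasso _≟ˢ_ state↣Fin T)

  markFree⇔ : ∀ {μ π} → IsTransientPeriod (orbit S) μ π → (¬ Manifests S) ⇔ MarkFree S (μ + π)
  markFree⇔ T = mk⇔
    (λ never t _ → Bool.¬-not λ mark → never (t , mark))
    (λ free (t , mark) →
      let r , r<ℓ , same , _ = reduce (transientPeriod⇒lasso _≟ˢ_ state↣Fin T) t
      in case trans (sym mark) (trans (cong (λ s → lookup s (observed S)) same) (free r r<ℓ)) of λ ())

  -- The bound depends on the dimension alone, so manifestation can be decided without computing
  -- transient and period.
  manifests⇔bounded : Manifests S ⇔ (∃ λ t → t < 2 ^ n × behaviour S t ≡ true)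
  manifests⇔bounded = mk⇔
    (λ (t , mark) → let r , r<2ⁿ , same = revisits _≟ˢ_ state↣Fin t
                    in r , r<2ⁿ , trans (cong (λ s → lookup s (observed S)) (sym same)) mark)
    (λ (t , _ , mark) → t , mark)

  behaviour-ultimatelyPeriodic : UltimatelyPeriodic (behaviour S)
  behaviour-ultimatelyPeriodic =
    let μ , π , T = system-transientPeriod
        0<π , periodic = IsTransientPeriod.periodic T
    in μ , π , 0<π , λ t μ≤t → cong (λ s → lookup s (observed S)) (periodic t μ≤t)

-- Programs for re-entry systems

opaque
  exprᵀ : Closed (nat ⇒ Letter ⇒ nat)
  exprᵀ = foldᵀ ∙ lam (lam (lam (cases
    ( lam (v0 ∙ v2)
    ∷ lam (notᵀ ∙ (v1 ∙ v2 ∙ v0))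
    ∷ lam (orᵀ ∙ (v1 ∙ (π₁ᵀ ∙ v2) ∙ v0) ∙ (v1 ∙ (π₂ᵀ ∙ v2) ∙ v0))
    ∷ []) ∙ v2)))

  expr≡ : ∀ {β} (e : Expr n) (s : State n) → x ≡ codeExpr e → β ≈ s → ⟦ exprᵀ ⟧ γ x β ≡ bit (eval e s)
  expr≡ e s x≡ = fold-induction codeExpr (λ e f → ∀ {β} → β ≈ s → f β ≡ bit (eval e s)) (λ where
    f (var i)    IH → 0 , toℕ i , refl , λ β≈s → β≈s i
    f (cross e)  IH → 1 , codeExpr e , refl , λ β≈s → not≡ (IH {e} refl (right<pair 0 _) β≈s)
    f (juxt d e) IH →
      let l = codeExpr d
          r = codeExpr e
      in 2 , ⟨ l , r ⟩ , refl , λ β≈s →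
         or≡ (IH {d} (pair-π₁≡ {n = r} refl) (left<node 1 l r) β≈s)
             (IH {e} (pair-π₂≡ {m = l} refl) (right<node 1 l r) β≈s)) {i = e} x≡

codeOf : ∃ System → ℕ
codeOf (n , S) = codeSystem S

initialCode equationsCode : System n → ℕ
initialCode S   = codeList (List.map bit (Vec.toList (initial S)))
equationsCode S = codeList (List.map codeExpr (Vec.toList (equations S)))

opaque
  dimensionᵀ observedᵀ initialᵀ equationsᵀ : Closed (nat ⇒ nat)
  dimensionᵀ = lam (π₁ᵀ ∙ v0)
  observedᵀ  = lam (π₁ᵀ ∙ (π₂ᵀ ∙ v0))
  initialᵀ   = lam (π₁ᵀ ∙ (π₂ᵀ ∙ (π₂ᵀ ∙ v0)))
  equationsᵀ = lam (π₂ᵀ ∙ (π₂ᵀ ∙ (π₂ᵀ ∙ v0)))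

  dimension≡ : (S : System n) → x ≡ codeSystem S → ⟦ dimensionᵀ ⟧ γ x ≡ n
  dimension≡ S x≡ = pair-π₁≡ {n = ⟨ toℕ (observed S) , ⟨ initialCode S , equationsCode S ⟩ ⟩} x≡

  observed≡ : (S : System n) → x ≡ codeSystem S → ⟦ observedᵀ ⟧ γ x ≡ toℕ (observed S)
  observed≡ {n = n} S x≡ = pair-π₁≡ {n = ⟨ initialCode S , equationsCode S ⟩} (pair-π₂≡ {m = n} x≡)

  initial≡ : (S : System n) → x ≡ codeSystem S → ⟦ initialᵀ ⟧ γ x ≡ initialCode S
  initial≡ {n = n} S x≡ = pair-π₁≡ {n = equationsCode S}
    (pair-π₂≡ {m = toℕ (observed S)} (pair-π₂≡ {m = n} x≡))

  equations≡ : (S : System n) → x ≡ codeSystem S → ⟦ equationsᵀ ⟧ γ x ≡ equationsCode S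
  equations≡ {n = n} S x≡ = pair-π₂≡ {m = initialCode S}
    (pair-π₂≡ {m = toℕ (observed S)} (pair-π₂≡ {m = n} x≡))

opaque
  orbitᵀ : Closed (nat ⇒ nat ⇒ Letter)
  orbitᵀ = lam (lam (rec (lam (nthᵀ ∙ v0 ∙ (initialᵀ ∙ v2)))
    (lam (lam (lam (exprᵀ ∙ (nthᵀ ∙ v0 ∙ (equationsᵀ ∙ v4)) ∙ v1)))) v0))

  orbit≈ : (S : System n) → x ≡ codeSystem S → y ≡ m → ⟦ orbitᵀ ⟧ γ x y ≈ orbit S m
  orbit≈ {m = m} S x≡ refl = primRec-induction {A = ℕ → ℕ} (λ t β → β ≈ orbit S t)
    (λ i → nth≡ bit (initial S) i refl (initial≡ S x≡))
    (λ {t} IH i → trans (expr≡ (lookup (equations S) i) (orbit S t) (nth≡ codeExpr (equations S) i refl (equations≡ S x≡)) IH)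
      (cong bit (sym (Vec.lookup-map i (λ e → eval e (orbit S t)) (equations S))))) m

opaque
  behaviourᵀ : Closed (nat ⇒ nat ⇒ nat)
  behaviourᵀ = lam (lam (orbitᵀ ∙ v1 ∙ v0 ∙ (observedᵀ ∙ v1)))

  decides-mark : (S : System n) → x ≡ codeSystem S → y ≡ m →
                 Decides (⟦ behaviourᵀ ⟧ γ x y) (behaviour S m ≡ true)
  decides-mark {x = x} {y = y} {γ = γ} S x≡ y≡ = bit⇒decides (trans
    (cong (⟦ orbitᵀ ⟧ (y ∷ x ∷ γ) x y) (observed≡ S x≡))
    (orbit≈ S x≡ y≡ (observed S)))

opaque
  sameStateᵀ : Closed (nat ⇒ nat ⇒ nat ⇒ nat)
  sameStateᵀ = lam (lam (lam (notᵀ ∙ (existsᵀ ∙ (dimensionᵀ ∙ v2) ∙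
    lam (notᵀ ∙ (eqᵀ ∙ (orbitᵀ ∙ v3 ∙ v2 ∙ v0) ∙ (orbitᵀ ∙ v3 ∙ v1 ∙ v0)))))))

  decides-sameState : ∀ {z} (S : System n) → x ≡ codeSystem S → y ≡ m → z ≡ k →
                      Decides (⟦ sameStateᵀ ⟧ γ x y z) (orbit S m ≡ orbit S k)
  decides-sameState {n} {m = m} {k = k} S x≡ y≡ z≡ = decides-map
    (mk⇔ (λ agree → vec-ext λ i → decidable-stable (lookup (orbit S m) i Bool.≟ lookup (orbit S k) i)
                                    λ ≢ → agree (i , ≢))
         (λ { eq (i , ≢) → ≢ (cong (λ s → lookup s i) eq) }))
    (decides-¬ (decides-∃Fin (dimension≡ S x≡) λ i → decides-¬ (decides-map (mk⇔ bit-injective (cong bit))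
      (decides-≡ (orbit≈ S x≡ y≡ i) (orbit≈ S x≡ z≡ i)))))

opaque
  manifestsᵀ : Closed (nat ⇒ nat)
  manifestsᵀ = lam (existsᵀ ∙ (pow2ᵀ ∙ (dimensionᵀ ∙ v0)) ∙ lam (behaviourᵀ ∙ v1 ∙ v0))

  decides-manifests : (S : System n) → x ≡ codeSystem S → Decides (⟦ manifestsᵀ ⟧ γ x) (Manifests S)
  decides-manifests S x≡ = decides-map (⇔-sym (manifests⇔bounded S))
    (decides-∃< (pow2≡ (dimension≡ S x≡)) λ t _ → decides-mark S x≡ refl)

opaque
  lassoᵀ : Closed (nat ⇒ nat)
  lassoᵀ = lam (lam (lam (lam
    (andᵀ ∙ (andᵀ ∙ (posᵀ ∙ v0) ∙
            (andᵀ ∙ (sameStateᵀ ∙ v2 ∙ (addᵀ ∙ v1 ∙ v0) ∙ v1) ∙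
             (forallᵀ ∙ (addᵀ ∙ v1 ∙ v0) ∙ lam (forallᵀ ∙ v0 ∙ lam (notᵀ ∙ (sameStateᵀ ∙ v4 ∙ v0 ∙ v1))))))
          ∙ (forallᵀ ∙ (addᵀ ∙ v1 ∙ v0) ∙ lam (notᵀ ∙ (behaviourᵀ ∙ v3 ∙ v0))))))
    ∙ (π₁ᵀ ∙ v0) ∙ (π₁ᵀ ∙ (π₂ᵀ ∙ v0)) ∙ (π₂ᵀ ∙ (π₂ᵀ ∙ v0)))

  -- `IsTransientPeriod` compares with all eventual periods and cannot be tested as it stands; what
  -- the program tests is the equivalent `Lasso`.
  decides-transientPeriod : ∀ {w} (S : System n) → x ≡ ⟨ codeSystem S , w ⟩ →
    Decides (⟦ lassoᵀ ⟧ γ x) (IsTransientPeriod (orbit S) (π₁ w) (π₂ w) × MarkFree S (π₁ w + π₂ w))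
  decides-transientPeriod {x = x} {w = w} S x≡ = decides-×
    (decides-map (mk⇔
        (λ (0<π , closed , new) → from (transientPeriod⇔lasso S _ _)
          record { positive = 0<π ; closes = closed ; distinct = new })
        (λ T → let L = to (transientPeriod⇔lasso S _ _) T in positive L , closes L , distinct L))
      (decides-× (decides-pos π≡)
        (decides-× (decides-sameState S p≡ (add≡ μ≡ π≡) μ≡)
          (decides-∀< (add≡ μ≡ π≡) λ j _ → decides-∀< refl λ i _ → decides-¬ (decides-sameState S p≡ refl refl)))))
    (decides-map (mk⇔ (λ free t t<ℓ → Bool.¬-not (free t t<ℓ))
                      (λ free t t<ℓ mark → case trans (sym mark) (free t t<ℓ) of λ ()))
      (decides-∀< (add≡ μ≡ π≡) λ t _ → decides-¬ (decides-mark S p≡ refl)))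
    where
    p≡ : ∀ {Γ} {γ : Env Γ} → ⟦ π₁ᵀ ⟧ γ x ≡ codeSystem S
    p≡ = pair-π₁≡ {n = w} x≡
    μ≡ : ∀ {Γ} {γ : Env Γ} → ⟦ π₁ᵀ ⟧ γ (⟦ π₂ᵀ ⟧ γ x) ≡ π₁ w
    μ≡ = π₁≡ {m = w} (pair-π₂≡ {m = codeSystem S} x≡)
    π≡ : ∀ {Γ} {γ : Env Γ} → ⟦ π₂ᵀ ⟧ γ (⟦ π₂ᵀ ⟧ γ x) ≡ π₂ w
    π≡ = π₂≡ {m = w} (pair-π₂≡ {m = codeSystem S} x≡)

-- The domain quantifies n and S separately.
uncurry⇔ : {R : ∃ System → Set} → (∃ R) ⇔ (∃ λ n → ∃ λ (S : System n) → R (n , S))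
uncurry⇔ = mk⇔ (λ ((n , S) , r) → n , S , r) (λ (n , S , r) → (n , S) , r)

ManifestsOf : ∃ System → Set
ManifestsOf (n , S) = Manifests S

CertificateOf : ℕ → ∃ System → Set
CertificateOf w (n , S) = IsTransientPeriod (orbit S) (π₁ w) (π₂ w) × MarkFree S (π₁ w + π₂ w)

reEntry-decidable : DecidableDomain ReEntry
reEntry-decidable = compute manifestsᵀ , λ { p (n , S , p≡) → decide-answers manifestsᵀ
  (decides-map uncurry⇔ (Coded.decides-coded codeOf ManifestsOf {i = n , S}
    (λ {(n , S)} → decides-manifests S) p≡)) }

manifests⇔𝐌 : (S : System n) → 𝐌 ReEntry (codeSystem S) ⇔ Manifests S
manifests⇔𝐌 {n} S = Coded.coded⇔ codeOf ManifestsOf {x = ⟦ manifestsᵀ ⟧ [] (codeSystem S)} {i = n , S}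
  (λ {(n , S)} → decides-manifests S) ⇔-∘ ⇔-sym uncurry⇔

certificate⇔ : ∀ p w → TransientPeriodCertificate p w ⇔ (∃ λ i → p ≡ codeOf i × CertificateOf w i)
certificate⇔ p w = mk⇔
  (λ { (n , S , μ , π , p≡ , refl , cert) → (n , S) , p≡ ,
       subst (λ (μ , π) → IsTransientPeriod (orbit S) μ π × MarkFree S (μ + π)) (sym (unpair-pair μ π)) cert })
  (λ ((n , S) , p≡ , cert) → n , S , π₁ w , π₂ w , p≡ , sym (pair-unpair w) , cert)

transientPeriod-certifies : ∀ p → Dist ReEntry p →
  (¬ 𝐌 ReEntry p) ⇔ (∃ λ w → TransientPeriodCertificate p w)
transientPeriod-certifies p (n , S , p≡) = mk⇔
  (λ ¬m → let μ , π , T = system-transientPeriod S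
          in ⟨ μ , π ⟩ , n , S , μ , π , p≡ , refl , T ,
             to (markFree⇔ S T) (λ m → ¬m (n , S , p≡ , m)))
  -- As for sentences, the certificate may name another system with the same code.
  (λ { (w , n′ , S′ , μ , π , refl , _ , T , free) m →
       from (markFree⇔ S′ T) free (to (manifests⇔𝐌 S′) m) })

reEntry-certificates : CertificateScheme ReEntry TransientPeriodCertificate
reEntry-certificates = certifies-by lassoᵀ
  (λ { {p} (n , S , p≡) w → decides-map (⇔-sym (certificate⇔ p w))
       (Coded.decides-coded codeOf (CertificateOf w) {i = n , S}
         (λ {(_ , S)} p≡ → decides-transientPeriod S (cong ⟨_, w ⟩ p≡)) p≡) })
  transientPeriod-certifies

-- Makes the bound on `μ + π` effective: it is read off the presentation without running the system.
stateBoundᵀ : Closed (nat ⇒ nat)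
stateBoundᵀ = lam (pow2ᵀ ∙ (dimensionᵀ ∙ v0))

stateBound⇓ : (S : System n) → compute stateBoundᵀ ⟨ codeSystem S ⟩⇓ 2 ^ n
stateBound⇓ S = compute⇓ stateBoundᵀ (pow2≡ (dimension≡ S refl))

proposition4p2 : ((D : Domain) → DecidableDomain D →
    Total D (χ D) × Computable D (χ D) × Correct D (χ D))
    × (((φ : Sentence) → 𝐌 Presburger (codeFormula φ) ⇔ (ℕ⊨ φ))
    × DecidableDomain Presburger
    × CertifiedDecision Presburger AcceptingCertificate RejectingCertificate
    × Certifies Presburger (𝐌 Presburger) AcceptingCertificate
    × CertificateScheme Presburger RejectingCertificate)
    × ((∀ {n} (S : System n) →
    (𝐌 ReEntry (codeSystem S) ⇔ Manifests S)
    × (State n ↣ Fin (2 ^ n))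
    × (∀ s t → orbit S s ≡ orbit S t → orbit S (suc s) ≡ orbit S (suc t))
    × UltimatelyPeriodic (behaviour S)
    × (∃ λ μ → ∃ λ π → IsTransientPeriod (orbit S) μ π)
    × (∀ μ π → IsTransientPeriod (orbit S) μ π →
    ((¬ Manifests S) ⇔ MarkFree S (μ + π)) × μ + π ≤ 2 ^ n))
    × DecidableDomain ReEntry
    × CertificateScheme ReEntry TransientPeriodCertificate
    × (∃ λ c → ∀ {n} (S : System n) → c ⟨ codeSystem S ⟩⇓ 2 ^ n))
proposition4p2 =
  (λ D decidable → χ-total D decidable , χ-computable D decidable , χ-correct D decidable) ,
  ( truth⇔𝐌
  , presburger-decidable
  , presburger-certifiedDecision
  , presburger-acceptingCertificates
  , presburger-rejectingCertificates
  ) ,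
  (λ S → manifests⇔𝐌 S
       , state↣Fin
       , (λ _ _ → cong (next S))
       , behaviour-ultimatelyPeriodic S
       , system-transientPeriod S
       , (λ _ _ T → markFree⇔ S T , transientPeriod-bounded S T)) ,
  reEntry-decidable ,
  reEntry-certificates ,
  compute stateBoundᵀ , stateBound⇓
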